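{- For every integer $k \geq 2$ there is a constant $\alpha_k$ with $2k-1 < \alpha_k < 2k - \tfrac{1}{2}$ such that the number of palstars of length $2n$ over a $k$-letter alphabet is $\Theta(\alpha_k^n)$ as $n \to \infty$.
   Context: Let $\Sigma_k$ be an alphabet with $k$ letters and let $P = \{ x x^R : x \in \Sigma_k^+\}$ be the set of nonempty even-length palindromes over $\Sigma_k$ (here $x^R$ is the reversal of $x$). A palstar is an element of $P^* = \bigcup_{i\ge 0} P^i$, i.e. a (possibly empty) concatenation of nonempty even-length palindromes. -}

module Defs where

import Algebra.Properties.Ring as RingProperties
open import Data.Fin using (Fin)
import Data.Fin.Properties as Fin
open import Data.Integer using (+_)
open import Data.List using (List; []; _∷_; _++_; length; reverse; filter; allFin; cartesianProductWith)
import Data.List.Properties as List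
open import Data.Nat as ℕ using (ℕ; zero; suc)
import Data.Nat.Properties as ℕ
open import Data.Product using (∃; ∃₂; _×_; _,_; proj₁; proj₂)
open import Data.Rational as ℚ using (ℚ; 0ℚ; 1ℚ; ½; ∣_∣; 1/_)
import Data.Rational.Properties as ℚ
open import Data.Rational.Literals using (fromℤ)
open import Data.Sum using (inj₁; inj₂)
open import Relation.Binary.PropositionalEquality
open import Relation.Nullary using (Dec; yes; no; ¬_; contradiction)
open import Relation.Nullary.Decidable using (map′; _×-dec_; _⊎-dec_; ¬?)

Language : Set → Set₁
Language A = List A → Set

Pow : ∀ {A} → Language A → ℕ → Language A
Pow L zero    w = w ≡ []
Pow L (suc i) w = ∃₂ λ u v → w ≡ u ++ v × L u × Pow L i v

Star : ∀ {A} → Language A → Language A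
Star L w = ∃ λ i → Pow L i w

EvenPalindrome : ∀ {A} → Language A
EvenPalindrome w = ∃ λ x → ¬ (x ≡ []) × w ≡ x ++ reverse x

Palstar : ∀ {A} → Language A
Palstar = Star EvenPalindrome

module _ {A : Set} where

  split? : {Q : List A → List A → Set} → (∀ u v → Dec (Q u v)) →
           ∀ w → Dec (∃₂ λ u v → w ≡ u ++ v × Q u v)
  split? Q? [] = map′
    (λ q → [] , [] , refl , q)
    (λ { ([] , [] , refl , q) → q ; ([] , _ ∷ _ , () , _) ; (_ ∷ _ , _ , () , _) })
    (Q? [] [])
  split? Q? (a ∷ w) = map′
    (λ { (inj₁ q) → [] , a ∷ w , refl , q
       ; (inj₂ (u , v , eq , q)) → a ∷ u , v , cong (a ∷_) eq , q })
    (λ { ([] , _ , refl , q) → inj₁ q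
       ; (_ ∷ u , v , refl , q) → inj₂ (u , v , refl , q) })
    (Q? [] (a ∷ w) ⊎-dec split? (λ u v → Q? (a ∷ u) v) w)

  module _ {L : Language A} (L? : ∀ w → Dec (L w)) where

    Pow? : ((w : List A) → Dec (w ≡ [])) → ∀ i w → Dec (Pow L i w)
    Pow? []? zero    w = []? w
    Pow? []? (suc i) w = split? (λ u v → L? u ×-dec Pow? []? i v) w

  Pow-length : {L : Language A} → ¬ L [] → ∀ i {w} → Pow L i w → i ℕ.≤ length w
  Pow-length ε∉L zero    _ = ℕ.z≤n
  Pow-length ε∉L (suc i) ([] , v , _ , l , _) = contradiction l ε∉L
  Pow-length ε∉L (suc i) (a ∷ u , v , refl , _ , p) = ℕ.s≤s
    (ℕ.≤-trans (Pow-length ε∉L i p)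
      (subst (length v ℕ.≤_) (sym (List.length-++ u)) (ℕ.m≤n+m (length v) (length u))))

  []∉EvenPalindrome : ¬ EvenPalindrome {A} []
  []∉EvenPalindrome ([] , x≢[] , _) = x≢[] refl
  []∉EvenPalindrome (_ ∷ _ , _ , ())

  module _ (_≟_ : (w w′ : List A) → Dec (w ≡ w′)) where

    EvenPalindrome? : ∀ w → Dec (EvenPalindrome w)
    EvenPalindrome? w = map′
      (λ { (x , _ , eq , x≢[] , refl) → x , x≢[] , eq })
      (λ { (x , x≢[] , eq) → x , reverse x , eq , x≢[] , refl })
      (split? (λ x y → ¬? (x ≟ []) ×-dec (y ≟ reverse x)) w)

    Palstar? : ∀ w → Dec (Palstar w)
    Palstar? w = map′
      (λ { (i , _ , p) → i , p })
      (λ { (i , p) → i , ℕ.s≤s (Pow-length []∉EvenPalindrome i p) , p })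
      (ℕ.anyUpTo? (λ i → Pow? EvenPalindrome? (_≟ []) i w) (suc (length w)))

-- Each word of length m over Fin k occurs exactly once in this list.
words : (k m : ℕ) → List (List (Fin k))
words k zero    = [] ∷ []
words k (suc m) = cartesianProductWith _∷_ (allFin k) (words k m)

numPalstars : (k m : ℕ) → ℕ
numPalstars k m = length (filter (Palstar? (List.≡-dec Fin._≟_)) (words k m))

-- Real numbers, as Cauchy sequences of rationals.  The order relations
-- below respect the equivalence of Cauchy sequences, so no quotient is
-- needed to speak about inequalities.

IsCauchy : (ℕ → ℚ) → Set
IsCauchy x = ∀ ε → 0ℚ ℚ.< ε →
  ∃ λ N → ∀ m n → N ℕ.≤ m → N ℕ.≤ n → ∣ x m ℚ.- x n ∣ ℚ.< ε

record ℝ : Set where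
  constructor mkℝ
  field
    seq    : ℕ → ℚ
    cauchy : IsCauchy seq

open ℝ public

infix 4 _<_ _≤_ _∈Θ_
infixl 7 _*_
infixr 8 _^_

_<_ : ℝ → ℝ → Set
x < y = ∃ λ ε → 0ℚ ℚ.< ε × ∃ λ N → ∀ n → N ℕ.≤ n → seq x n ℚ.+ ε ℚ.≤ seq y n

_≤_ : ℝ → ℝ → Set
x ≤ y = ∀ ε → 0ℚ ℚ.< ε → ∃ λ N → ∀ n → N ℕ.≤ n → seq x n ℚ.≤ seq y n ℚ.+ ε

fromℚ : ℚ → ℝ
fromℚ q = mkℝ (λ _ → q) λ ε 0<ε → 0 , λ _ _ _ _ →
  subst (λ d → ∣ d ∣ ℚ.< ε) (sym (ℚ.+-inverseʳ q)) 0<ε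

ℕ→ℚ : ℕ → ℚ
ℕ→ℚ n = fromℤ (+ n)

fromℕ : ℕ → ℝ
fromℕ n = fromℚ (ℕ→ℚ n)

module ℚ-Ring = RingProperties ℚ.+-*-ring

[p-q]+q≡p : ∀ p q → (p ℚ.- q) ℚ.+ q ≡ p
[p-q]+q≡p p q = trans (ℚ.+-assoc p (ℚ.- q) q)
  (trans (cong (p ℚ.+_) (ℚ.+-inverseˡ q)) (ℚ.+-identityʳ p))

p-q≡[p-r]+[r-q] : ∀ p q r → p ℚ.- q ≡ (p ℚ.- r) ℚ.+ (r ℚ.- q)
p-q≡[p-r]+[r-q] p q r = sym
  (trans (sym (ℚ.+-assoc (p ℚ.- r) r (ℚ.- q))) (cong (ℚ._- q) ([p-q]+q≡p p r)))

ab-cd : ∀ a b c d → a ℚ.* b ℚ.- c ℚ.* d ≡ a ℚ.* (b ℚ.- d) ℚ.+ (a ℚ.- c) ℚ.* d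
ab-cd a b c d = trans (p-q≡[p-r]+[r-q] (a ℚ.* b) (c ℚ.* d) (a ℚ.* d))
  (sym (cong₂ ℚ._+_ (ℚ-Ring.x[y-z]≈xy-xz a b d) (ℚ-Ring.[y-z]x≈yx-zx d a c)))

EventuallyBounded : (ℕ → ℚ) → Set
EventuallyBounded x = ∃ λ B → ℚ.Positive B × ∃ λ N → ∀ n → N ℕ.≤ n → ∣ x n ∣ ℚ.≤ B

cauchy⇒bounded : ∀ {x} → IsCauchy x → EventuallyBounded x
cauchy⇒bounded {x} cx with cx 1ℚ (ℚ.positive⁻¹ 1ℚ)
... | N , close = 1ℚ ℚ.+ ∣ x N ∣ , pos , N , bound
  where
  pos : ℚ.Positive (1ℚ ℚ.+ ∣ x N ∣)
  pos = ℚ.pos+nonNeg⇒pos 1ℚ ∣ x N ∣ {{ℚ.∣-∣-nonNeg (x N)}}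

  bound : ∀ n → N ℕ.≤ n → ∣ x n ∣ ℚ.≤ 1ℚ ℚ.+ ∣ x N ∣
  bound n N≤n = begin
    ∣ x n ∣                        ≡⟨ cong ∣_∣ (sym ([p-q]+q≡p (x n) (x N))) ⟩
    ∣ (x n ℚ.- x N) ℚ.+ x N ∣      ≤⟨ ℚ.∣p+q∣≤∣p∣+∣q∣ (x n ℚ.- x N) (x N) ⟩
    ∣ x n ℚ.- x N ∣ ℚ.+ ∣ x N ∣    ≤⟨ ℚ.+-monoˡ-≤ ∣ x N ∣ (ℚ.<⇒≤ (close n N N≤n ℕ.≤-refl)) ⟩
    1ℚ ℚ.+ ∣ x N ∣                 ∎
    where open ℚ.≤-Reasoning

scaled : ∀ {x} → IsCauchy x → ∀ B → ℚ.Positive B → ∀ ε → 0ℚ ℚ.< ε →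
         ∃ λ N → ∀ m n → N ℕ.≤ m → N ℕ.≤ n → B ℚ.* ∣ x m ℚ.- x n ∣ ℚ.< ε
scaled {x} cx B B>0 ε 0<ε = proj₁ c , λ m n p q →
  subst (B ℚ.* ∣ x m ℚ.- x n ∣ ℚ.<_) B*δ≡ε
    (ℚ.*-monoʳ-<-pos B {{B>0}} (proj₂ c m n p q))
  where
  instance
    B≢0 : ℚ.NonZero B
    B≢0 = ℚ.pos⇒nonZero B {{B>0}}

  δ : ℚ
  δ = 1/ B ℚ.* ε

  c = cx δ (ℚ.positive⁻¹ δ {{ℚ.pos*pos⇒pos (1/ B) {{ℚ.1/pos⇒pos B {{B>0}}}} ε {{ℚ.positive 0<ε}}}})

  B*δ≡ε : B ℚ.* δ ≡ ε
  B*δ≡ε = trans (sym (ℚ.*-assoc B (1/ B) ε))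
    (trans (cong (ℚ._* ε) (ℚ.*-inverseʳ B)) (ℚ.*-identityˡ ε))

*-cauchy : ∀ {x y} → IsCauchy x → IsCauchy y → IsCauchy (λ n → x n ℚ.* y n)
*-cauchy {x} {y} cx cy ε 0<ε with cauchy⇒bounded {x} cx | cauchy⇒bounded {y} cy
... | B , B>0 , N₁ , ∣x∣≤B | C , C>0 , N₂ , ∣y∣≤C
  with scaled {y} cy B B>0 (½ ℚ.* ε) 0<½ε | scaled {x} cx C C>0 (½ ℚ.* ε) 0<½ε
  where
  0<½ε : 0ℚ ℚ.< ½ ℚ.* ε
  0<½ε = ℚ.positive⁻¹ (½ ℚ.* ε) {{ℚ.pos*pos⇒pos ½ ε {{ℚ.positive 0<ε}}}}
... | N₃ , close-y | N₄ , close-x = N , close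
  where
  open ℚ.≤-Reasoning
  N = (N₁ ℕ.⊔ N₂) ℕ.⊔ (N₃ ℕ.⊔ N₄)

  close : ∀ m n → N ℕ.≤ m → N ℕ.≤ n → ∣ x m ℚ.* y m ℚ.- x n ℚ.* y n ∣ ℚ.< ε
  close m n N≤m N≤n = begin-strict
    ∣ x m ℚ.* y m ℚ.- x n ℚ.* y n ∣
      ≡⟨ cong ∣_∣ (trans (ab-cd (x m) (y m) (x n) (y n)) (cong (x m ℚ.* dy ℚ.+_) (ℚ.*-comm dx (y n)))) ⟩
    ∣ x m ℚ.* dy ℚ.+ y n ℚ.* dx ∣
      ≤⟨ ℚ.∣p+q∣≤∣p∣+∣q∣ (x m ℚ.* dy) (y n ℚ.* dx) ⟩
    ∣ x m ℚ.* dy ∣ ℚ.+ ∣ y n ℚ.* dx ∣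
      ≡⟨ cong₂ ℚ._+_ (ℚ.∣p*q∣≡∣p∣*∣q∣ (x m) dy) (ℚ.∣p*q∣≡∣p∣*∣q∣ (y n) dx) ⟩
    ∣ x m ∣ ℚ.* ∣ dy ∣ ℚ.+ ∣ y n ∣ ℚ.* ∣ dx ∣
      ≤⟨ ℚ.+-mono-≤
           (ℚ.*-monoʳ-≤-nonNeg ∣ dy ∣ {{ℚ.∣-∣-nonNeg dy}} (∣x∣≤B m (ℕ.≤-trans N₁≤N N≤m)))
           (ℚ.*-monoʳ-≤-nonNeg ∣ dx ∣ {{ℚ.∣-∣-nonNeg dx}} (∣y∣≤C n (ℕ.≤-trans N₂≤N N≤n))) ⟩
    B ℚ.* ∣ dy ∣ ℚ.+ C ℚ.* ∣ dx ∣
      <⟨ ℚ.+-mono-<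
           (close-y m n (ℕ.≤-trans N₃≤N N≤m) (ℕ.≤-trans N₃≤N N≤n))
           (close-x m n (ℕ.≤-trans N₄≤N N≤m) (ℕ.≤-trans N₄≤N N≤n)) ⟩
    ½ ℚ.* ε ℚ.+ ½ ℚ.* ε
      ≡⟨ trans (sym (ℚ.*-distribʳ-+ ε ½ ½)) (ℚ.*-identityˡ ε) ⟩
    ε ∎
    where
    dx = x m ℚ.- x n
    dy = y m ℚ.- y n
    N₁≤N : N₁ ℕ.≤ N
    N₁≤N = ℕ.≤-trans (ℕ.m≤m⊔n N₁ N₂) (ℕ.m≤m⊔n (N₁ ℕ.⊔ N₂) (N₃ ℕ.⊔ N₄))
    N₂≤N : N₂ ℕ.≤ N
    N₂≤N = ℕ.≤-trans (ℕ.m≤n⊔m N₁ N₂) (ℕ.m≤m⊔n (N₁ ℕ.⊔ N₂) (N₃ ℕ.⊔ N₄))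
    N₃≤N : N₃ ℕ.≤ N
    N₃≤N = ℕ.≤-trans (ℕ.m≤m⊔n N₃ N₄) (ℕ.m≤n⊔m (N₁ ℕ.⊔ N₂) (N₃ ℕ.⊔ N₄))
    N₄≤N : N₄ ℕ.≤ N
    N₄≤N = ℕ.≤-trans (ℕ.m≤n⊔m N₃ N₄) (ℕ.m≤n⊔m (N₁ ℕ.⊔ N₂) (N₃ ℕ.⊔ N₄))

_*_ : ℝ → ℝ → ℝ
x * y = mkℝ (λ n → seq x n ℚ.* seq y n) (*-cauchy {seq x} {seq y} (cauchy x) (cauchy y))

_^_ : ℝ → ℕ → ℝ
x ^ zero  = fromℚ 1ℚ
x ^ suc n = x * x ^ n

-- f = Θ(g) as n → ∞, for f and g with nonnegative values.
_∈Θ_ : (f g : ℕ → ℝ) → Set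
f ∈Θ g = ∃₂ λ c C → fromℚ 0ℚ < c × fromℚ 0ℚ < C ×
  ∃ λ n₀ → ∀ n → n₀ ℕ.≤ n → c * g n ≤ f n × f n ≤ C * g n

{-# OPTIONS --safe #-}

-- Call an even palindrome prime if it has no proper prefix that is a nonempty even
-- palindrome.  If u is prime and a proper prefix of an even palindrome w, the copies of u
-- at the two ends of w cannot overlap, since the overlap would be a shorter even palindrome;
-- so w = u y u with y an even palindrome or empty.  Hence palstars factor uniquely into
-- primes, and x xᴿ is prime iff x ≠ ε has no even palindromic prefix.
--
-- Let q(n) count the words of length n without even palindromic prefix and f(n) the palstars
-- of length 2n.  Then f(n) = Σ q(i) f(n-i) over 1 ≤ i ≤ n, and k q(n) = q(n+1) + e(n+1), where
-- e(2j) = q(j) and e(odd) = 0.  These give f(n+2) = 2k f(n+1) - Σ q(j) f(n+2-2j), whence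
-- 2k - 1 + 1/8 ≤ f(n+1)/f(n) ≤ 2k - 1/2 - 1/(8k-2) (n ≥ 2), and, as kⁿ ≤ 4 q(n),
-- f(m) f(n) ≤ f(m+n) ≤ 5 f(m) f(n).  The last property makes the n-th roots of f(n) converge
-- to some α with αⁿ/5 ≤ f(n) ≤ αⁿ.
module Submission where

open import Data.Nat as ℕ using (ℕ; zero; suc; z≤n; s≤s)
import Data.Nat.Properties as ℕ
open import Data.Nat.Divisibility using (_∣_; divides; ∣m+n∣m⇒∣n)
open import Data.Nat.Induction using (<-rec)
open import Data.Nat.Tactic.RingSolver using (solve-∀)
open import Data.Integer as ℤ using ()
import Data.Integer.Properties as ℤ
open import Data.Rational as ℚ using (ℚ; mkℚ; 0ℚ; 1ℚ; ½; ∣_∣; 1/_)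
import Data.Rational.Properties as ℚ
import Data.Rational.Unnormalised as ℚᵘ
import Data.Rational.Unnormalised.Properties as ℚᵘ
open import Data.Fin as Fin using (Fin)
import Data.Fin.Properties as Fin
open import Data.List using (List; []; _∷_; _++_; length; reverse; take; drop; map; filter; allFin; tabulate; cartesianProductWith)
import Data.List.Properties as List
open import Data.Product using (∃; ∃₂; _×_; _,_; proj₁; proj₂)
open import Data.Sum using (_⊎_; inj₁; inj₂)
open import Function using (_∘_; id)
open import Algebra.Bundles using (CommutativeMonoid)
import Algebra.Properties.CommutativeSemigroup as CommutativeSemigroupProperties
open import Relation.Binary.PropositionalEquality
open import Relation.Nullary using (Dec; yes; no; ¬_; contradiction)
open import Relation.Nullary.Decidable using (_×-dec_; ¬?)

-- Strict inequality of reals asks for a fixed rational gap, and this shapes the ratio bounds. The j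
-- = 1 term of the recurrence together with f(n+1) ≤ 2k f(n) gives only 2k - 1/2; feeding that bound
-- back once more yields something strictly smaller. From below, comparing e with q coefficient by
-- coefficient gives only 2k - 1; the extra 1/8 is the contribution of one odd index, where e
-- vanishes and q does not.
--
-- Convergence of the ratios themselves would require excluding oscillation. Multiplicativity up to
-- a constant avoids this and gives the limit of the roots with an explicit rate. As reals are
-- Cauchy sequences of rationals, roots are replaced by integer floors, and all estimates are
-- inequalities in ℕ between N-th powers. Bernoulli's inequality bounds the N-th root of a constant
-- B by 1 + B/N.
--
-- Unique factorisation enters the count only as cancellation of a prime left factor, so no list of
-- factors is ever built: a word is read letter by letter until its first prime factor is complete.

module ℕ-+ = CommutativeSemigroupProperties ℕ.+-commutativeSemigroup
module ℕ-* = CommutativeSemigroupProperties ℕ.*-commutativeSemigroup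
module ℚ-* = CommutativeSemigroupProperties (CommutativeMonoid.commutativeSemigroup ℚ.*-1-commutativeMonoid)

-- Renewal equations over ℕ

module Renewal where

  open import Data.Nat using (_+_; _*_; _^_; _≤_; _<_)
  open ℕ-* using (x∙yz≈y∙xz)

  -- The Cauchy product Σ g(i) h(n-i) over 0 ≤ i ≤ n. Shifting `g` instead of indexing by n-i keeps
  -- truncated subtraction out of every later proof.
  conv : (ℕ → ℕ) → (ℕ → ℕ) → ℕ → ℕ
  conv g h zero    = g 0 * h 0
  conv g h (suc n) = g 0 * h (suc n) + conv (g ∘ suc) h n

  conv-monoˡ : ∀ {g g′} h n → (∀ i → g i ≤ g′ i) → conv g h n ≤ conv g′ h n
  conv-monoˡ h zero    le = ℕ.*-monoˡ-≤ (h 0) (le 0)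
  conv-monoˡ h (suc n) le = ℕ.+-mono-≤ (ℕ.*-monoˡ-≤ (h (suc n)) (le 0)) (conv-monoˡ h n (le ∘ suc))

  conv-congˡ : ∀ {g g′} h n → (∀ i → g i ≡ g′ i) → conv g h n ≡ conv g′ h n
  conv-congˡ h zero    eq = cong (_* h 0) (eq 0)
  conv-congˡ h (suc n) eq = cong₂ _+_ (cong (_* h (suc n)) (eq 0)) (conv-congˡ h n (eq ∘ suc))

  conv-+ˡ : ∀ g g′ h n → conv (λ i → g i + g′ i) h n ≡ conv g h n + conv g′ h n
  conv-+ˡ g g′ h zero    = ℕ.*-distribʳ-+ (h 0) (g 0) (g′ 0)
  conv-+ˡ g g′ h (suc n) = trans (cong ((g 0 + g′ 0) * h (suc n) +_) (conv-+ˡ (g ∘ suc) (g′ ∘ suc) h n))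
    (lemma (g 0) (g′ 0) (h (suc n)) (conv (g ∘ suc) h n) (conv (g′ ∘ suc) h n))
    where
    lemma : ∀ a b c u v → (a + b) * c + (u + v) ≡ (a * c + u) + (b * c + v)
    lemma = solve-∀

  conv-*ˡ : ∀ c g h n → conv (λ i → c * g i) h n ≡ c * conv g h n
  conv-*ˡ c g h zero    = ℕ.*-assoc c (g 0) (h 0)
  conv-*ˡ c g h (suc n) = trans (cong (c * g 0 * h (suc n) +_) (conv-*ˡ c (g ∘ suc) h n))
    (lemma c (g 0) (h (suc n)) (conv (g ∘ suc) h n))
    where
    lemma : ∀ c a b u → c * a * b + c * u ≡ c * (a * b + u)
    lemma = solve-∀

  conv-*ʳ : ∀ c g h n → conv g (λ i → c * h i) n ≡ c * conv g h n
  conv-*ʳ c g h zero    = lemma c (g 0) (h 0)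
    where
    lemma : ∀ c a b → a * (c * b) ≡ c * (a * b)
    lemma = solve-∀
  conv-*ʳ c g h (suc n) = trans (cong (g 0 * (c * h (suc n)) +_) (conv-*ʳ c (g ∘ suc) h n))
    (lemma c (g 0) (h (suc n)) (conv (g ∘ suc) h n))
    where
    lemma : ∀ c a b u → a * (c * b) + c * u ≡ c * (a * b + u)
    lemma = solve-∀

  head≤conv : ∀ g h n → g 0 * h n ≤ conv g h n
  head≤conv g h zero    = ℕ.≤-refl
  head≤conv g h (suc n) = ℕ.m≤m+n _ _

  conv-head-mono : ∀ {g g′} h n c → g 0 + c ≤ g′ 0 → (∀ i → g (suc i) ≤ g′ (suc i)) →
                   conv g h n + c * h n ≤ conv g′ h n
  conv-head-mono {g} {g′} h zero    c le₀ le = begin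
    g 0 * h 0 + c * h 0 ≡⟨ ℕ.*-distribʳ-+ (h 0) (g 0) c ⟨
    (g 0 + c) * h 0     ≤⟨ ℕ.*-monoˡ-≤ (h 0) le₀ ⟩
    g′ 0 * h 0          ∎
    where open ℕ.≤-Reasoning
  conv-head-mono {g} {g′} h (suc n) c le₀ le = begin
    g 0 * h (suc n) + u + c * h (suc n) ≡⟨ lemma (g 0) (h (suc n)) u c ⟩
    (g 0 + c) * h (suc n) + u           ≤⟨ ℕ.+-mono-≤ (ℕ.*-monoˡ-≤ (h (suc n)) le₀) (conv-monoˡ h n le) ⟩
    g′ 0 * h (suc n) + conv (g′ ∘ suc) h n ∎
    where
    open ℕ.≤-Reasoning
    u = conv (g ∘ suc) h n
    lemma : ∀ a b u c → a * b + u + c * b ≡ (a + c) * b + u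
    lemma = solve-∀

  -- The sum is cut after the index i = m. When i + 1 is the half-length of the first prime factor,
  -- this separates the palstars whose first factor ends by half-length m + 1 from those where it
  -- reaches further.
  conv-split : ∀ g h m n → conv g h (m + suc n) ≡
               conv g (λ j → h (j + suc n)) m + conv (λ i → g (suc m + i)) h n
  conv-split g h zero    n = refl
  conv-split g h (suc m) n = trans (cong (g 0 * h (suc m + suc n) +_) (conv-split (g ∘ suc) h m n))
    (sym (ℕ.+-assoc (g 0 * h (suc m + suc n)) _ _))

  -- Only the last term contains `h 0`, so slack available there alone pays for a multiple of `g m`.
  -- The bound on j is what lets an induction hypothesis serve as the last premise.
  conv-last-mono : ∀ g {h h′} m c → h 0 + c ≤ h′ 0 → (∀ j → j < m → h (suc j) ≤ h′ (suc j)) →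
                   conv g h m + g m * c ≤ conv g h′ m
  conv-last-mono g {h} {h′} zero    c le₀ le = begin
    g 0 * h 0 + g 0 * c ≡⟨ ℕ.*-distribˡ-+ (g 0) (h 0) c ⟨
    g 0 * (h 0 + c)     ≤⟨ ℕ.*-monoʳ-≤ (g 0) le₀ ⟩
    g 0 * h′ 0          ∎
    where open ℕ.≤-Reasoning
  conv-last-mono g {h} {h′} (suc m) c le₀ le = begin
    g 0 * h (suc m) + conv (g ∘ suc) h m + g (suc m) * c   ≡⟨ ℕ.+-assoc (g 0 * h (suc m)) _ _ ⟩
    g 0 * h (suc m) + (conv (g ∘ suc) h m + g (suc m) * c)
      ≤⟨ ℕ.+-mono-≤ (ℕ.*-monoʳ-≤ (g 0) (le m ℕ.≤-refl))
           (conv-last-mono (g ∘ suc) m c le₀ (λ j j<m → le j (ℕ.m<n⇒m<1+n j<m))) ⟩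
    g 0 * h′ (suc m) + conv (g ∘ suc) h′ m                 ∎
    where open ℕ.≤-Reasoning

  parity : ∀ m → ∃ λ j → m ≡ j + j ⊎ m ≡ suc (j + j)
  parity zero = 0 , inj₁ refl
  parity (suc m) with parity m
  ... | j , inj₁ refl = j , inj₂ refl
  ... | j , inj₂ refl = suc j , inj₁ (cong suc (sym (ℕ.+-suc j j)))

  -- Here e(n) counts the primes of length n. Writing k as 2 + t makes k - 1 = 1 + t, 4k - 1 = 7 +
  -- 4t and the like polynomials over ℕ, within reach of the ring solver.
  module Growth (t : ℕ) (q e f : ℕ → ℕ)
    (q-0      : q 0 ≡ 1)
    (q-suc    : ∀ n → (2 + t) * q n ≡ q (suc n) + e (suc n))
    (e-odd    : ∀ j → e (suc (j + j)) ≡ 0)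
    (e-double : ∀ j → e (suc j + suc j) ≡ q (suc j))
    (f-0      : f 0 ≡ 1)
    (f-suc    : ∀ n → f (suc n) ≡ conv (q ∘ suc) f n)
    where

    open ℕ.≤-Reasoning

    private
      k : ℕ
      k = 2 + t

    q-odd : ∀ j → q (suc (j + j)) ≡ k * q (j + j)
    q-odd j = sym (trans (q-suc (j + j)) (trans (cong (q (suc (j + j)) +_) (e-odd j)) (ℕ.+-identityʳ _)))

    q-even : ∀ j → q (suc j + suc j) + q (suc j) ≡ k * (k * q (j + j))
    q-even j = begin-equality
      q (suc j + suc j) + q (suc j)             ≡⟨ cong (q (suc j + suc j) +_) (e-double j) ⟨
      q (suc (j + suc j)) + e (suc (j + suc j)) ≡⟨ q-suc (j + suc j) ⟨
      k * q (j + suc j)                         ≡⟨ cong (λ i → k * q i) (ℕ.+-suc j j) ⟩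
      k * q (suc (j + j))                       ≡⟨ cong (k *_) (q-odd j) ⟩
      k * (k * q (j + j))                       ∎

    q-1 : q 1 ≡ k
    q-1 = trans (q-odd 0) (trans (cong (k *_) q-0) (ℕ.*-identityʳ k))

    q-2 : q 2 ≡ (1 + t) * k
    q-2 = ℕ.+-cancelʳ-≡ k (q 2) ((1 + t) * k) (begin-equality
      q 2 + k       ≡⟨ cong (q 2 +_) q-1 ⟨
      q 2 + q 1     ≡⟨ q-even 0 ⟩
      k * (k * q 0) ≡⟨ cong (λ z → k * (k * z)) q-0 ⟩
      k * (k * 1)   ≡⟨ lemma t ⟩
      (1 + t) * k + k ∎)
      where
      lemma : ∀ t → (2 + t) * ((2 + t) * 1) ≡ (1 + t) * (2 + t) + (2 + t)
      lemma = solve-∀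

    q-suc≤ : ∀ n → q (suc n) ≤ k * q n
    q-suc≤ n = subst (q (suc n) ≤_) (sym (q-suc n)) (ℕ.m≤m+n _ _)

    e≤q⇒q≤q-suc : ∀ n → e (suc n) ≤ q n → q n ≤ q (suc n)
    e≤q⇒q≤q-suc n e≤q = ℕ.+-cancelʳ-≤ (e (suc n)) (q n) (q (suc n)) (begin
      q n + e (suc n)       ≤⟨ ℕ.+-monoʳ-≤ (q n) e≤q ⟩
      q n + q n             ≤⟨ ℕ.+-monoʳ-≤ (q n) (ℕ.m≤m+n (q n) (t * q n)) ⟩
      k * q n               ≡⟨ q-suc n ⟩
      q (suc n) + e (suc n) ∎)

    -- The even case needs q(j+1) ≤ q(2j+1), hence monotonicity of q below m. That in turn follows
    -- from this very bound at smaller indices, because k ≥ 2; so both are obtained in one strong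
    -- induction.
    e-suc≤q : ∀ m → e (suc m) ≤ q m
    e-suc≤q = <-rec (λ m → e (suc m) ≤ q m) step
      where
      mono : ∀ a d → (∀ {i} → i < a + d → e (suc i) ≤ q i) → q a ≤ q (a + d)
      mono a zero    rec = ℕ.≤-reflexive (cong q (sym (ℕ.+-identityʳ a)))
      mono a (suc d) rec rewrite ℕ.+-suc a d =
        ℕ.≤-trans (mono a d (λ i< → rec (ℕ.m<n⇒m<1+n i<))) (e≤q⇒q≤q-suc (a + d) (rec ℕ.≤-refl))

      step : ∀ m → (∀ {i} → i < m → e (suc i) ≤ q i) → e (suc m) ≤ q m
      step m rec with parity m
      ... | j , inj₁ refl = subst (_≤ q (j + j)) (sym (e-odd j)) z≤n
      ... | j , inj₂ refl = begin
        e (suc (suc (j + j))) ≡⟨ cong (e ∘ suc) (ℕ.+-suc j j) ⟨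
        e (suc j + suc j)     ≡⟨ e-double j ⟩
        q (suc j)             ≤⟨ mono (suc j) j rec ⟩
        q (suc j + j)         ∎

    -- The factor k - 1 in place of k comes from q(2) = k (k - 1). The induction for `q-lower` then
    -- has slack proportional to (k - 1)(k - 2), which is zero at k = 2; the trivial bound by a
    -- power of k would fail there.
    q-upper : ∀ n → q (2 + n) ≤ (1 + t) * k ^ (1 + n)
    q-upper zero    = ℕ.≤-reflexive (trans q-2 (cong ((1 + t) *_) (sym (ℕ.*-identityʳ k))))
    q-upper (suc n) = begin
      q (3 + n)                     ≤⟨ q-suc≤ (2 + n) ⟩
      k * q (2 + n)                 ≤⟨ ℕ.*-monoʳ-≤ k (q-upper n) ⟩
      k * ((1 + t) * k ^ (1 + n))   ≡⟨ x∙yz≈y∙xz k (1 + t) (k ^ (1 + n)) ⟩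
      (1 + t) * k ^ (2 + n)         ∎

    -- The summand 2 kʲ⁺¹ is what makes the induction go through.
    q-lower : ∀ j → k ^ suc j * k ^ suc j + 2 * k ^ suc j ≤ 4 * q (suc j + suc j)
    q-lower zero = begin
      k * 1 * (k * 1) + 2 * (k * 1)                ≤⟨ ℕ.m≤m+n _ (3 * t * k) ⟩
      k * 1 * (k * 1) + 2 * (k * 1) + 3 * t * k    ≡⟨ lemma t ⟩
      4 * ((1 + t) * k)                            ≡⟨ cong (4 *_) q-2 ⟨
      4 * q 2                                      ∎
      where
      lemma : ∀ t → (2 + t) * 1 * ((2 + t) * 1) + 2 * ((2 + t) * 1) + 3 * t * (2 + t) ≡
              4 * ((1 + t) * (2 + t))
      lemma = solve-∀
    q-lower (suc j) = ℕ.+-cancelʳ-≤ (4 * q (2 + j)) _ _ (begin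
      k * X * (k * X) + 2 * (k * X) + 4 * q (2 + j)        ≤⟨ ℕ.+-monoʳ-≤ (k * X * (k * X) + 2 * (k * X)) (ℕ.*-monoʳ-≤ 4 (q-upper j)) ⟩
      k * X * (k * X) + 2 * (k * X) + 4 * ((1 + t) * X)    ≤⟨ ℕ.m≤m+n _ (2 * (t * ((1 + t) * X))) ⟩
      k * X * (k * X) + 2 * (k * X) + 4 * ((1 + t) * X) + 2 * (t * ((1 + t) * X)) ≡⟨ lemma t X ⟩
      k * (k * (X * X + 2 * X))                            ≤⟨ ℕ.*-monoʳ-≤ k (ℕ.*-monoʳ-≤ k (q-lower j)) ⟩
      k * (k * (4 * q (suc j + suc j)))                    ≡⟨ lemma₂ k (q (suc j + suc j)) ⟩
      4 * (k * (k * q (suc j + suc j)))                    ≡⟨ cong (4 *_) (q-even (suc j)) ⟨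
      4 * (q (2 + j + (2 + j)) + q (2 + j))                ≡⟨ ℕ.*-distribˡ-+ 4 (q (2 + j + (2 + j))) (q (2 + j)) ⟩
      4 * q (2 + j + (2 + j)) + 4 * q (2 + j)              ∎)
      where
      X = k ^ suc j
      lemma : ∀ t X → (2 + t) * X * ((2 + t) * X) + 2 * ((2 + t) * X) + 4 * ((1 + t) * X) + 2 * (t * ((1 + t) * X))
              ≡ (2 + t) * ((2 + t) * (X * X + 2 * X))
      lemma = solve-∀
      lemma₂ : ∀ k x → k * (k * (4 * x)) ≡ 4 * (k * (k * x))
      lemma₂ = solve-∀

    k^n≤4q : ∀ n → k ^ n ≤ 4 * q n
    k^n≤4q n with parity n
    ... | j , inj₁ refl = even j
      where
      even : ∀ j → k ^ (j + j) ≤ 4 * q (j + j)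
      even zero    = subst (λ z → 1 ≤ 4 * z) (sym q-0) (s≤s z≤n)
      even (suc j) = begin
        k ^ (suc j + suc j)                         ≡⟨ ℕ.^-distribˡ-+-* k (suc j) (suc j) ⟩
        k ^ suc j * k ^ suc j                       ≤⟨ ℕ.m≤m+n _ _ ⟩
        k ^ suc j * k ^ suc j + 2 * k ^ suc j       ≤⟨ q-lower j ⟩
        4 * q (suc j + suc j)                       ∎
    ... | j , inj₂ refl = begin
      k * k ^ (j + j)         ≤⟨ ℕ.*-monoʳ-≤ k (k^n≤4q (j + j)) ⟩
      k * (4 * q (j + j))     ≡⟨ lemma k (q (j + j)) ⟩
      4 * (k * q (j + j))     ≡⟨ cong (4 *_) (q-odd j) ⟨
      4 * q (suc (j + j))     ∎
      where
      lemma : ∀ k x → k * (4 * x) ≡ 4 * (k * x)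
      lemma = solve-∀

    q-+≤ : ∀ a b → q (a + b) ≤ q a * k ^ b
    q-+≤ a zero    = ℕ.≤-reflexive (trans (cong q (ℕ.+-identityʳ a)) (sym (ℕ.*-identityʳ (q a))))
    q-+≤ a (suc b) = begin
      q (a + suc b)       ≡⟨ cong q (ℕ.+-suc a b) ⟩
      q (suc (a + b))     ≤⟨ q-suc≤ (a + b) ⟩
      k * q (a + b)       ≤⟨ ℕ.*-monoʳ-≤ k (q-+≤ a b) ⟩
      k * (q a * k ^ b)   ≡⟨ x∙yz≈y∙xz k (q a) (k ^ b) ⟩
      q a * k ^ suc b     ∎

    q-submultiplicative : ∀ a b → q (a + b) ≤ (q a * 4) * q b
    q-submultiplicative a b = begin
      q (a + b)        ≤⟨ q-+≤ a b ⟩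
      q a * k ^ b      ≤⟨ ℕ.*-monoʳ-≤ (q a) (k^n≤4q b) ⟩
      q a * (4 * q b)  ≡⟨ ℕ.*-assoc (q a) 4 (q b) ⟨
      (q a * 4) * q b  ∎

    -- Split by the first prime factor. If it ends by half-length m + 1, the induction hypothesis
    -- applies to the rest. Otherwise its count q(m+1+i) is at most 4 q(m+1) q(i), and these terms
    -- sum to 4 q(m+1) f(n+1). The term with empty rest contributes q(m+1) f(n+1), so the two
    -- together need the constant 5 = 1 + 4.
    f-submultiplicative⁺ : ∀ n m → f (suc m + suc n) ≤ 5 * f (suc n) * f (suc m)
    f-submultiplicative⁺ n = <-rec (λ m → f (suc m + suc n) ≤ 5 * y * f (suc m)) step
      where
      y = f (suc n)
      step : ∀ m → (∀ {j} → j < m → f (suc j + suc n) ≤ 5 * y * f (suc j)) →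
             f (suc m + suc n) ≤ 5 * y * f (suc m)
      step m rec = begin
        f (suc m + suc n)
          ≡⟨ f-suc (m + suc n) ⟩
        conv (q ∘ suc) f (m + suc n)
          ≡⟨ conv-split (q ∘ suc) f m n ⟩
        conv (q ∘ suc) h m + conv (λ i → q (suc (suc m + i))) f n
          ≤⟨ ℕ.+-monoʳ-≤ (conv (q ∘ suc) h m) (conv-monoˡ f n λ i →
               subst (λ l → q l ≤ q (suc m) * 4 * q (suc i)) (ℕ.+-suc (suc m) i)
                 (q-submultiplicative (suc m) (suc i))) ⟩
        conv (q ∘ suc) h m + conv (λ i → q (suc m) * 4 * q (suc i)) f n
          ≡⟨ cong (conv (q ∘ suc) h m +_) (conv-*ˡ (q (suc m) * 4) (q ∘ suc) f n) ⟩
        conv (q ∘ suc) h m + q (suc m) * 4 * conv (q ∘ suc) f n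
          ≡⟨ cong (λ z → conv (q ∘ suc) h m + q (suc m) * 4 * z) (f-suc n) ⟨
        conv (q ∘ suc) h m + q (suc m) * 4 * y
          ≡⟨ cong (conv (q ∘ suc) h m +_) (ℕ.*-assoc (q (suc m)) 4 y) ⟩
        conv (q ∘ suc) h m + q (suc m) * (4 * y)
          ≤⟨ conv-last-mono (q ∘ suc) m (4 * y)
               (ℕ.≤-reflexive (trans (lemma y) (cong (5 * y *_) (sym f-0)))) (λ j → rec) ⟩
        conv (q ∘ suc) (λ j → 5 * y * f j) m
          ≡⟨ conv-*ʳ (5 * y) (q ∘ suc) f m ⟩
        5 * y * conv (q ∘ suc) f m
          ≡⟨ cong (5 * y *_) (f-suc m) ⟨
        5 * y * f (suc m) ∎
        where
        h = λ j → f (j + suc n)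
        lemma : ∀ y → y + 4 * y ≡ 5 * y * 1
        lemma = solve-∀

    f-submultiplicative : ∀ m n → f (m + n) ≤ 5 * (f m * f n)
    f-submultiplicative zero n = begin
      f n             ≤⟨ ℕ.m≤m+n (f n) (4 * f n) ⟩
      5 * f n         ≡⟨ cong (5 *_) (ℕ.*-identityˡ (f n)) ⟨
      5 * (1 * f n)   ≡⟨ cong (λ z → 5 * (z * f n)) f-0 ⟨
      5 * (f 0 * f n) ∎
    f-submultiplicative (suc m) zero = begin
      f (suc m + 0)         ≡⟨ cong f (ℕ.+-identityʳ (suc m)) ⟩
      f (suc m)             ≤⟨ ℕ.m≤m+n (f (suc m)) (4 * f (suc m)) ⟩
      5 * f (suc m)         ≡⟨ cong (5 *_) (ℕ.*-identityʳ (f (suc m))) ⟨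
      5 * (f (suc m) * 1)   ≡⟨ cong (λ z → 5 * (f (suc m) * z)) f-0 ⟨
      5 * (f (suc m) * f 0) ∎
    f-submultiplicative (suc m) (suc n) = begin
      f (suc m + suc n)         ≤⟨ f-submultiplicative⁺ n m ⟩
      5 * f (suc n) * f (suc m) ≡⟨ lemma (f (suc n)) (f (suc m)) ⟩
      5 * (f (suc m) * f (suc n)) ∎
      where
      lemma : ∀ a b → 5 * a * b ≡ 5 * (b * a)
      lemma = solve-∀

    -- Linear recurrence for f and bounds on its ratios

    f-1 : f 1 ≡ k
    f-1 = trans (f-suc 0) (trans (cong₂ _*_ q-1 f-0) (ℕ.*-identityʳ k))

    -- In generating functions: F(x) (1 - 2 k x + Q(x²)) = 1 - k x, where Q(x) = Σ q(j) xʲ over j ≥ 1.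
    f-recurrence : ∀ n → 2 * k * f (suc n) ≡ f (2 + n) + conv (e ∘ (2 +_)) f n
    f-recurrence n = begin-equality
      2 * k * f (suc n)
        ≡⟨ lemma k (f (suc n)) ⟩
      k * (1 * f (suc n) + f (suc n))
        -- With q(0) = 1 as an additional term the convolution starts at index 0, so the relation
        -- between q and e can be applied to every coefficient.
        ≡⟨ cong₂ (λ a b → k * (a * f (suc n) + b)) (sym q-0) (f-suc n) ⟩
      k * conv q f (suc n)
        ≡⟨ conv-*ˡ k q f (suc n) ⟨
      conv (λ i → k * q i) f (suc n)
        ≡⟨ conv-congˡ f (suc n) q-suc ⟩
      conv (λ i → q (suc i) + e (suc i)) f (suc n)
        ≡⟨ conv-+ˡ (q ∘ suc) (e ∘ suc) f (suc n) ⟩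
      conv (q ∘ suc) f (suc n) + (e 1 * f (suc n) + conv (e ∘ (2 +_)) f n)
        ≡⟨ cong₂ (λ a b → a + (b * f (suc n) + conv (e ∘ (2 +_)) f n)) (sym (f-suc (suc n))) (e-odd 0) ⟩
      f (2 + n) + conv (e ∘ (2 +_)) f n ∎
      where
      lemma : ∀ k x → 2 * k * x ≡ k * (1 * x + x)
      lemma = solve-∀

    f-upper₁ : ∀ n → f (2 + n) + k * f n ≤ 2 * k * f (suc n)
    f-upper₁ n = begin
      f (2 + n) + k * f n                 ≡⟨ cong (λ z → f (2 + n) + z * f n) (trans (e-double 0) q-1) ⟨
      f (2 + n) + e 2 * f n               ≤⟨ ℕ.+-monoʳ-≤ (f (2 + n)) (head≤conv (e ∘ (2 +_)) f n) ⟩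
      f (2 + n) + conv (e ∘ (2 +_)) f n   ≡⟨ f-recurrence n ⟨
      2 * k * f (suc n)                   ∎

    f-suc≤ : ∀ n → f (suc n) ≤ 2 * k * f n
    f-suc≤ zero    = begin
      f 1           ≡⟨ f-1 ⟩
      k             ≤⟨ ℕ.m≤m+n k k ⟩
      k + k         ≡⟨ lemma k ⟩
      2 * k * 1     ≡⟨ cong (2 * k *_) f-0 ⟨
      2 * k * f 0   ∎
      where
      lemma : ∀ k → k + k ≡ 2 * k * 1
      lemma = solve-∀
    f-suc≤ (suc n) = ℕ.≤-trans (ℕ.m≤m+n _ _) (f-upper₁ n)

    -- The ratio is (4k - 1)/2 = 2k - 1/2. It comes from replacing k f(n) in `f-upper₁` by its lower
    -- bound f(n+1)/2.
    f-upper₂ : ∀ n → 2 * f (suc n) ≤ (7 + 4 * t) * f n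
    f-upper₂ zero = begin
      2 * f 1                     ≡⟨ cong (2 *_) f-1 ⟩
      2 * k                       ≤⟨ ℕ.m≤m+n (2 * k) (3 + 2 * t) ⟩
      2 * k + (3 + 2 * t)         ≡⟨ lemma t ⟩
      (7 + 4 * t) * 1             ≡⟨ cong ((7 + 4 * t) *_) f-0 ⟨
      (7 + 4 * t) * f 0           ∎
      where
      lemma : ∀ t → 2 * (2 + t) + (3 + 2 * t) ≡ (7 + 4 * t) * 1
      lemma = solve-∀
    f-upper₂ (suc n) = ℕ.+-cancelʳ-≤ (f (suc n)) _ _ (begin
      2 * f (2 + n) + f (suc n)         ≤⟨ ℕ.+-monoʳ-≤ (2 * f (2 + n)) (f-suc≤ n) ⟩
      2 * f (2 + n) + 2 * k * f n       ≡⟨ lemma (f (2 + n)) k (f n) ⟩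
      2 * (f (2 + n) + k * f n)         ≤⟨ ℕ.*-monoʳ-≤ 2 (f-upper₁ n) ⟩
      2 * (2 * k * f (suc n))           ≡⟨ lemma₂ t (f (suc n)) ⟩
      (7 + 4 * t) * f (suc n) + f (suc n) ∎)
      where
      lemma : ∀ a k b → 2 * a + 2 * k * b ≡ 2 * (a + k * b)
      lemma = solve-∀
      lemma₂ : ∀ t x → 2 * (2 * (2 + t) * x) ≡ (7 + 4 * t) * x + x
      lemma₂ = solve-∀

    -- The same argument again, now with k f(n) ≥ 2k f(n+1)/(4k - 1) from `f-upper₂`. The ratio 2k
    -- (4k - 2)/(4k - 1) lies strictly below 2k - 1/2.
    f-upper : ∀ n → (7 + 4 * t) * f (suc n) ≤ 2 * k * (6 + 4 * t) * f n
    f-upper zero = begin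
      (7 + 4 * t) * f 1               ≡⟨ cong ((7 + 4 * t) *_) f-1 ⟩
      (7 + 4 * t) * k                 ≤⟨ ℕ.m≤m+n _ ((5 + 4 * t) * k) ⟩
      (7 + 4 * t) * k + (5 + 4 * t) * k ≡⟨ lemma t ⟩
      2 * k * (6 + 4 * t) * 1         ≡⟨ cong (2 * k * (6 + 4 * t) *_) f-0 ⟨
      2 * k * (6 + 4 * t) * f 0       ∎
      where
      lemma : ∀ t → (7 + 4 * t) * (2 + t) + (5 + 4 * t) * (2 + t) ≡ 2 * (2 + t) * (6 + 4 * t) * 1
      lemma = solve-∀
    f-upper (suc n) = ℕ.+-cancelʳ-≤ (k * (2 * f (suc n))) _ _ (begin
      (7 + 4 * t) * f (2 + n) + k * (2 * f (suc n))         ≤⟨ ℕ.+-monoʳ-≤ ((7 + 4 * t) * f (2 + n)) (ℕ.*-monoʳ-≤ k (f-upper₂ n)) ⟩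
      (7 + 4 * t) * f (2 + n) + k * ((7 + 4 * t) * f n)     ≡⟨ lemma (7 + 4 * t) (f (2 + n)) k (f n) ⟩
      (7 + 4 * t) * (f (2 + n) + k * f n)                   ≤⟨ ℕ.*-monoʳ-≤ (7 + 4 * t) (f-upper₁ n) ⟩
      (7 + 4 * t) * (2 * k * f (suc n))                     ≡⟨ lemma₂ t (f (suc n)) ⟩
      2 * k * (6 + 4 * t) * f (suc n) + k * (2 * f (suc n)) ∎)
      where
      lemma : ∀ a b k c → a * b + k * (a * c) ≡ a * (b + k * c)
      lemma = solve-∀
      lemma₂ : ∀ t x → (7 + 4 * t) * (2 * (2 + t) * x) ≡ 2 * (2 + t) * (6 + 4 * t) * x + (2 + t) * (2 * x)
      lemma₂ = solve-∀

    -- Coefficientwise e(i+2) ≤ q(i+1), with equality at i = 0. At i = 1 the left side is e(3) = 0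
    -- and the right side q(2), which leaves the surplus.
    conv-e-bound : ∀ n → conv (e ∘ (2 +_)) f (suc n) + q 2 * f n ≤ f (2 + n)
    conv-e-bound n = begin
      e 2 * f (suc n) + conv (e ∘ (3 +_)) f n + q 2 * f n
        ≡⟨ ℕ.+-assoc (e 2 * f (suc n)) _ _ ⟩
      e 2 * f (suc n) + (conv (e ∘ (3 +_)) f n + q 2 * f n)
        ≤⟨ ℕ.+-mono-≤ (ℕ.≤-reflexive (cong (_* f (suc n)) (e-double 0)))
             (conv-head-mono f n (q 2) (ℕ.≤-reflexive (cong (_+ q 2) (e-odd 1)))
               (λ i → e-suc≤q (3 + i))) ⟩
      conv (q ∘ suc) f (suc n)
        ≡⟨ f-suc (suc n) ⟨
      f (2 + n) ∎

    -- Origin of the 8: two steps multiply f by at most 4k², and 4k² ≤ 8k (k - 1) for k ≥ 2. Thus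
    -- the surplus in `conv-e-bound` is at least an eighth of f(n+2).
    f-2+≤ : ∀ n → f (2 + n) ≤ 8 * (q 2 * f n)
    f-2+≤ n = begin
      f (2 + n)                     ≤⟨ f-suc≤ (suc n) ⟩
      2 * k * f (suc n)             ≤⟨ ℕ.*-monoʳ-≤ (2 * k) (f-suc≤ n) ⟩
      2 * k * (2 * k * f n)         ≤⟨ ℕ.m≤m+n _ (4 * t * k * f n) ⟩
      2 * k * (2 * k * f n) + 4 * t * k * f n ≡⟨ lemma t (f n) ⟩
      8 * ((1 + t) * k * f n)       ≡⟨ cong (λ z → 8 * (z * f n)) q-2 ⟨
      8 * (q 2 * f n)               ∎
      where
      lemma : ∀ t x → 2 * (2 + t) * (2 * (2 + t) * x) + 4 * t * (2 + t) * x ≡ 8 * ((1 + t) * (2 + t) * x)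
      lemma = solve-∀

    f-lower : ∀ n → (25 + 16 * t) * f (2 + n) ≤ 8 * f (3 + n)
    f-lower n = ℕ.+-cancelʳ-≤ (8 * y) _ _ (begin
      (25 + 16 * t) * y + 8 * y     ≡⟨ lemma t y ⟩
      8 * (2 * k * y) + y           ≡⟨ cong (λ z → 8 * z + y) (f-recurrence (suc n)) ⟩
      8 * (f (3 + n) + c) + y       ≤⟨ ℕ.+-monoʳ-≤ (8 * (f (3 + n) + c)) (f-2+≤ n) ⟩
      8 * (f (3 + n) + c) + 8 * (q 2 * f n) ≡⟨ lemma₂ (f (3 + n)) c (q 2 * f n) ⟩
      8 * f (3 + n) + 8 * (c + q 2 * f n)   ≤⟨ ℕ.+-monoʳ-≤ (8 * f (3 + n)) (ℕ.*-monoʳ-≤ 8 (conv-e-bound n)) ⟩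
      8 * f (3 + n) + 8 * y         ∎)
      where
      y = f (2 + n)
      c = conv (e ∘ (2 +_)) f (suc n)
      lemma : ∀ t y → (25 + 16 * t) * y + 8 * y ≡ 8 * (2 * (2 + t) * y) + y
      lemma = solve-∀
      lemma₂ : ∀ a c b → 8 * (a + c) + 8 * b ≡ 8 * a + 8 * (c + b)
      lemma₂ = solve-∀

    1≤f : ∀ n → 1 ≤ f n
    1≤f zero    = ℕ.≤-reflexive (sym f-0)
    1≤f (suc n) = begin
      1                        ≤⟨ 1≤f n ⟩
      f n                      ≤⟨ ℕ.m≤m+n (f n) ((1 + t) * f n) ⟩
      k * f n                  ≡⟨ cong (_* f n) q-1 ⟨
      q 1 * f n                ≤⟨ head≤conv (q ∘ suc) f n ⟩
      conv (q ∘ suc) f n       ≡⟨ f-suc n ⟨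
      f (suc n)                ∎

    geometric-upper : ∀ a b → (∀ n → a * f (suc n) ≤ b * f n) → ∀ n → a ^ n * f n ≤ b ^ n
    geometric-upper a b step zero    = ℕ.≤-reflexive (trans (ℕ.*-identityˡ (f 0)) f-0)
    geometric-upper a b step (suc n) = begin
      a * a ^ n * f (suc n)    ≡⟨ lemma a (a ^ n) (f (suc n)) ⟩
      a ^ n * (a * f (suc n))  ≤⟨ ℕ.*-monoʳ-≤ (a ^ n) (step n) ⟩
      a ^ n * (b * f n)        ≡⟨ x∙yz≈y∙xz (a ^ n) b (f n) ⟩
      b * (a ^ n * f n)        ≤⟨ ℕ.*-monoʳ-≤ b (geometric-upper a b step n) ⟩
      b * b ^ n                ∎
      where
      lemma : ∀ a b c → a * b * c ≡ b * (a * c)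
      lemma = solve-∀

    f≤ : ∀ n → f n ≤ (2 * k) ^ n
    f≤ n = begin
      f n           ≡⟨ ℕ.*-identityˡ (f n) ⟨
      1 * f n       ≡⟨ cong (_* f n) (ℕ.^-zeroˡ n) ⟨
      1 ^ n * f n   ≤⟨ geometric-upper 1 (2 * k) (λ i → subst (_≤ 2 * k * f i) (sym (ℕ.*-identityˡ _)) (f-suc≤ i)) n ⟩
      (2 * k) ^ n   ∎

    T : ℕ
    T = 25 + 16 * t

    geometric-lower : ∀ n → T ^ n ≤ 8 ^ n * f (2 + n)
    geometric-lower zero    = ℕ.≤-trans (1≤f 2) (ℕ.≤-reflexive (sym (ℕ.*-identityˡ (f 2))))
    geometric-lower (suc n) = begin
      T * T ^ n                    ≤⟨ ℕ.*-monoʳ-≤ T (geometric-lower n) ⟩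
      T * (8 ^ n * f (2 + n))      ≡⟨ x∙yz≈y∙xz T (8 ^ n) (f (2 + n)) ⟩
      8 ^ n * (T * f (2 + n))      ≤⟨ ℕ.*-monoʳ-≤ (8 ^ n) (f-lower n) ⟩
      8 ^ n * (8 * f (3 + n))      ≡⟨ lemma₂ (8 ^ n) 8 (f (3 + n)) ⟩
      8 * 8 ^ n * f (3 + n)        ∎
      where
      lemma₂ : ∀ a b c → a * (b * c) ≡ b * a * c
      lemma₂ = solve-∀

    -- The factor `T ^ 2` pays for the two initial ratios that `f-lower` does not cover. A constant
    -- factor does not change the limit of the roots.
    T^n≤ : ∀ n → T ^ n ≤ T ^ 2 * (8 ^ n * f n)
    T^n≤ 0 = begin
      T ^ 0                ≤⟨ ℕ.^-monoʳ-≤ T {0} {2} z≤n ⟩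
      T ^ 2                ≡⟨ ℕ.*-identityʳ (T ^ 2) ⟨
      T ^ 2 * 1            ≤⟨ ℕ.*-monoʳ-≤ (T ^ 2) (ℕ.*-mono-≤ {1} {1} ℕ.≤-refl (1≤f 0)) ⟩
      T ^ 2 * (1 * f 0)    ∎
    T^n≤ 1 = begin
      T ^ 1                ≤⟨ ℕ.^-monoʳ-≤ T {1} {2} (s≤s z≤n) ⟩
      T ^ 2                ≡⟨ ℕ.*-identityʳ (T ^ 2) ⟨
      T ^ 2 * 1            ≤⟨ ℕ.*-monoʳ-≤ (T ^ 2) (ℕ.*-mono-≤ {1} {8} (s≤s z≤n) (1≤f 1)) ⟩
      T ^ 2 * (8 ^ 1 * f 1)    ∎
    T^n≤ (suc (suc n)) = begin
      T ^ (2 + n)                        ≡⟨ ℕ.^-distribˡ-+-* T 2 n ⟩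
      T ^ 2 * T ^ n                      ≤⟨ ℕ.*-monoʳ-≤ (T ^ 2) (geometric-lower n) ⟩
      T ^ 2 * (8 ^ n * f (2 + n))        ≤⟨ ℕ.*-monoʳ-≤ (T ^ 2) (ℕ.*-monoˡ-≤ (f (2 + n)) (ℕ.^-monoʳ-≤ 8 (ℕ.m≤n+m n 2))) ⟩
      T ^ 2 * (8 ^ (2 + n) * f (2 + n))  ∎

-- Growth rates of almost multiplicative sequences

module GrowthRate where

  open import Data.Nat using (_+_; _*_; _^_; _∸_; _≤_; _<_; _<?_; NonZero; >-nonZero)
  open ℕ-* using (x∙yz≈y∙xz)
  open ℕ.≤-Reasoning

  ^-distribʳ-* : ∀ n a b → (a * b) ^ n ≡ a ^ n * b ^ n
  ^-distribʳ-* zero    a b = refl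
  ^-distribʳ-* (suc n) a b = trans (cong (a * b *_) (^-distribʳ-* n a b)) (lemma a b (a ^ n) (b ^ n))
    where
    lemma : ∀ a b c d → a * b * (c * d) ≡ a * c * (b * d)
    lemma = solve-∀

  ^-comm : ∀ a m n → (a ^ m) ^ n ≡ (a ^ n) ^ m
  ^-comm a m n = trans (ℕ.^-*-assoc a m n) (trans (cong (a ^_) (ℕ.*-comm m n)) (sym (ℕ.^-*-assoc a n m)))

  ^-cancelˡ-≤ : ∀ n .{{_ : NonZero n}} {a b} → a ^ n ≤ b ^ n → a ≤ b
  ^-cancelˡ-≤ n {a} {b} le = ℕ.≮⇒≥ λ b<a → ℕ.<⇒≱ (ℕ.^-monoˡ-< n b<a) le

  ^-cancelˡ-< : ∀ n {a b} → a ^ n < b ^ n → a < b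
  ^-cancelˡ-< n {a} {b} lt = ℕ.≰⇒> λ b≤a → ℕ.<⇒≱ lt (ℕ.^-monoˡ-≤ n b≤a)

  nthRoot : ∀ i x → ∃ λ a → a ^ suc i ≤ x × x < suc a ^ suc i
  nthRoot i x = search (suc x) (ℕ.≤-trans (ℕ.≤-reflexive (sym (ℕ.*-identityʳ (suc x))))
      (ℕ.*-monoʳ-≤ (suc x) (ℕ.m^n>0 (suc x) i)))
    where
    search : ∀ b → x < b ^ suc i → ∃ λ a → a ^ suc i ≤ x × x < suc a ^ suc i
    search (suc b) x<b with x <? b ^ suc i
    ... | yes x<b′ = search b x<b′
    ... | no  x≮b′ = b , ℕ.≮⇒≥ x≮b′ , x<b

  -- Bernoulli's inequality (1 + m (b / n)) ≤ (1 + b / n)ᵐ, cleared of denominators.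
  bernoulli : ∀ n b m → (n + m * b) * n ^ m ≤ n * (n + b) ^ m
  bernoulli n b zero    = ℕ.≤-reflexive (lemma n)
    where
    lemma : ∀ n → (n + 0) * 1 ≡ n * 1
    lemma = solve-∀
  bernoulli n b (suc m) = begin
    (n + (b + m * b)) * (n * n ^ m)                      ≤⟨ ℕ.m≤m+n _ (m * b * b * n ^ m) ⟩
    (n + (b + m * b)) * (n * n ^ m) + m * b * b * n ^ m  ≡⟨ lemma n b m (n ^ m) ⟩
    (n + b) * ((n + m * b) * n ^ m)                      ≤⟨ ℕ.*-monoʳ-≤ (n + b) (bernoulli n b m) ⟩
    (n + b) * (n * (n + b) ^ m)                          ≡⟨ x∙yz≈y∙xz (n + b) n ((n + b) ^ m) ⟩
    n * ((n + b) * (n + b) ^ m)                          ∎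
    where
    lemma : ∀ n b m p → (n + (b + m * b)) * (n * p) + m * b * b * p ≡ (n + b) * ((n + m * b) * p)
    lemma = solve-∀

  -- This is the way constants disappear under roots: the n-th root of b is at most 1 + b/n.
  b*n^n≤[n+b]^n : ∀ n .{{_ : NonZero n}} b → b * n ^ n ≤ (n + b) ^ n
  b*n^n≤[n+b]^n n b = ℕ.*-cancelˡ-≤ n (begin
    n * (b * n ^ n)       ≤⟨ ℕ.m≤n+m _ (n * n ^ n) ⟩
    n * n ^ n + n * (b * n ^ n) ≡⟨ lemma n b (n ^ n) ⟩
    (n + n * b) * n ^ n   ≤⟨ bernoulli n b n ⟩
    n * (n + b) ^ n       ∎)
    where
    lemma : ∀ n b p → n * p + n * (b * p) ≡ (n + n * b) * p
    lemma = solve-∀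

  -- Bernoulli in the other direction, (1 + b/a)ⁿ ≤ 1/(1 - n b/a), with r standing for a - n b. Each
  -- factor is traded by (a + b) r ≤ a (r + b), valid since r ≤ a.
  [a+b]^n*r≤a^n*a : ∀ a b n r → a ≡ r + n * b → (a + b) ^ n * r ≤ a ^ n * a
  [a+b]^n*r≤a^n*a a b zero    r eq = ℕ.*-monoʳ-≤ 1 (subst (r ≤_) (sym eq) (ℕ.m≤m+n r 0))
  [a+b]^n*r≤a^n*a a b (suc n) r eq = begin
    (a + b) * (a + b) ^ n * r        ≡⟨ lemma a b ((a + b) ^ n) r ⟩
    (a + b) ^ n * (a * r + b * r)    ≤⟨ ℕ.*-monoʳ-≤ ((a + b) ^ n) (ℕ.+-monoʳ-≤ (a * r) (ℕ.*-monoʳ-≤ b r≤a)) ⟩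
    (a + b) ^ n * (a * r + b * a)    ≡⟨ lemma₂ a b ((a + b) ^ n) r ⟩
    a * ((a + b) ^ n * (r + b))      ≤⟨ ℕ.*-monoʳ-≤ a ([a+b]^n*r≤a^n*a a b n (r + b) (trans eq (sym (ℕ.+-assoc r b (n * b))))) ⟩
    a * (a ^ n * a)                  ≡⟨ ℕ.*-assoc a (a ^ n) a ⟨
    a * a ^ n * a                    ∎
    where
    r≤a : r ≤ a
    r≤a = subst (r ≤_) (sym eq) (ℕ.m≤m+n r _)
    lemma : ∀ a b p r → (a + b) * p * r ≡ p * (a * r + b * r)
    lemma = solve-∀
    lemma₂ : ∀ a b p r → p * (a * r + b * a) ≡ a * (p * (r + b))
    lemma₂ = solve-∀

  [a+b]^n≤2a^n : ∀ a .{{_ : NonZero a}} b n → 2 * (n * b) ≤ a → (a + b) ^ n ≤ 2 * a ^ n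
  [a+b]^n≤2a^n a b n 2nb≤a = ℕ.*-cancelʳ-≤ ((a + b) ^ n) (2 * a ^ n) a (begin
    (a + b) ^ n * a         ≤⟨ ℕ.*-monoʳ-≤ ((a + b) ^ n) a≤2r ⟩
    (a + b) ^ n * (2 * r)   ≡⟨ lemma ((a + b) ^ n) r ⟩
    2 * ((a + b) ^ n * r)   ≤⟨ ℕ.*-monoʳ-≤ 2 ([a+b]^n*r≤a^n*a a b n r (sym r+nb≡a)) ⟩
    2 * (a ^ n * a)         ≡⟨ ℕ.*-assoc 2 (a ^ n) a ⟨
    2 * a ^ n * a           ∎)
    where
    c = n * b
    r = a ∸ c
    r+nb≡a : r + c ≡ a
    r+nb≡a = ℕ.m∸n+n≡m (ℕ.≤-trans (ℕ.m≤m+n c (c + 0)) 2nb≤a)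
    a≤2r : a ≤ 2 * r
    a≤2r = ℕ.+-cancelʳ-≤ (2 * c) a (2 * r) (begin
      a + 2 * c       ≤⟨ ℕ.+-monoʳ-≤ a 2nb≤a ⟩
      a + a           ≡⟨ cong₂ _+_ (sym r+nb≡a) (sym r+nb≡a) ⟩
      (r + c) + (r + c) ≡⟨ lemma₂ r c ⟩
      2 * r + 2 * c   ∎)
      where
      lemma₂ : ∀ r c → (r + c) + (r + c) ≡ 2 * r + 2 * c
      lemma₂ = solve-∀
    lemma : ∀ p r → p * (2 * r) ≡ 2 * (p * r)
    lemma = solve-∀

  -- a i / suc i approximates the (suc i)-th root of f (suc i) from below.
  module Roots (f : ℕ → ℕ) (C U : ℕ)
    (f-0   : f 0 ≡ 1)
    (1≤f   : ∀ n → 1 ≤ f n)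
    (super : ∀ m n → f m * f n ≤ f (m + n))
    (sub   : ∀ m n → f (m + n) ≤ C * (f m * f n))
    (f≤    : ∀ n → f n ≤ U ^ n)
    where

    f^≤ : ∀ n m → f n ^ m ≤ f (m * n)
    f^≤ n zero    = 1≤f 0
    f^≤ n (suc m) = ℕ.≤-trans (ℕ.*-monoʳ-≤ (f n) (f^≤ n m)) (super n (m * n))

    ≤f^ : ∀ n m → f (m * n) ≤ C ^ m * f n ^ m
    ≤f^ n zero    = ℕ.≤-reflexive f-0
    ≤f^ n (suc m) = begin
      f (n + m * n)                     ≤⟨ sub n (m * n) ⟩
      C * (f n * f (m * n))             ≤⟨ ℕ.*-monoʳ-≤ C (ℕ.*-monoʳ-≤ (f n) (≤f^ n m)) ⟩
      C * (f n * (C ^ m * f n ^ m))     ≡⟨ lemma C (f n) (C ^ m) (f n ^ m) ⟩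
      C * C ^ m * (f n * f n ^ m)       ∎
      where
      lemma : ∀ a b c d → a * (b * (c * d)) ≡ a * c * (b * d)
      lemma = solve-∀

    -- The error allowance on `a`: 1 for rounding down, and B U + B for enlarging the rounded-up
    -- root, at most N U + 1, by the factor 1 + B/N. It does not depend on N, so it vanishes after
    -- division by N.
    margin : ℕ → ℕ
    margin B = 1 + B * U + B

    module _ (i : ℕ) where

      private
        N : ℕ
        N = suc i
        -- The factor `N ^ N` makes this the floor of N times the root of f(N), so that a/N is off
        -- by less than 1/N.
        root = nthRoot i (N ^ N * f N)

      a : ℕ
      a = proj₁ root

      a^N≤ : a ^ N ≤ N ^ N * f N
      a^N≤ = proj₁ (proj₂ root)

      ≤[1+a]^N : N ^ N * f N ≤ suc a ^ N
      ≤[1+a]^N = ℕ.<⇒≤ (proj₂ (proj₂ root))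

      N≤a : N ≤ a
      N≤a = ℕ.≤-pred (^-cancelˡ-< N (begin-strict
        N ^ N          ≡⟨ ℕ.*-identityʳ (N ^ N) ⟨
        N ^ N * 1      ≤⟨ ℕ.*-monoʳ-≤ (N ^ N) (1≤f N) ⟩
        N ^ N * f N    <⟨ proj₂ (proj₂ root) ⟩
        suc a ^ N      ∎))

      ratio-upper : ∀ x y → (∀ n → x ^ n * f n ≤ y ^ n) → x * a ≤ N * y
      ratio-upper x y le = ^-cancelˡ-≤ N (begin
        (x * a) ^ N               ≡⟨ ^-distribʳ-* N x a ⟩
        x ^ N * a ^ N             ≤⟨ ℕ.*-monoʳ-≤ (x ^ N) a^N≤ ⟩
        x ^ N * (N ^ N * f N)     ≡⟨ x∙yz≈y∙xz (x ^ N) (N ^ N) (f N) ⟩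
        N ^ N * (x ^ N * f N)     ≤⟨ ℕ.*-monoʳ-≤ (N ^ N) (le N) ⟩
        N ^ N * y ^ N             ≡⟨ ^-distribʳ-* N N y ⟨
        (N * y) ^ N               ∎)

      a≤N*U : a ≤ N * U
      a≤N*U = subst (_≤ N * U) (ℕ.*-identityˡ a) (ratio-upper 1 U λ n →
        subst (_≤ U ^ n) (sym (trans (cong (_* f n) (ℕ.^-zeroˡ n)) (ℕ.*-identityˡ (f n)))) (f≤ n))

      [N+B]*[1+a]≤ : ∀ B → (N + B) * suc a ≤ N * (a + margin B)
      [N+B]*[1+a]≤ B = begin
        (N + B) * suc a                  ≡⟨ lemma N B a ⟩
        N * suc a + (B * a + B * 1)      ≤⟨ ℕ.+-monoʳ-≤ (N * suc a) (ℕ.+-mono-≤ (ℕ.*-monoʳ-≤ B a≤N*U) (ℕ.*-monoʳ-≤ B (s≤s z≤n))) ⟩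
        N * suc a + (B * (N * U) + B * N) ≡⟨ lemma₂ N B a U ⟩
        N * (a + margin B)               ∎
        where
        lemma : ∀ n b a → (n + b) * (1 + a) ≡ n * (1 + a) + (b * a + b * 1)
        lemma = solve-∀
        lemma₂ : ∀ n b a u → n * (1 + a) + (b * (n * u) + b * n) ≡ n * (a + (1 + b * u + b))
        lemma₂ = solve-∀

      -- In N-th powers two copies of `N ^ N` are needed: one turns B into a power of N + B, the
      -- other belongs to the definition of `a`. Hence N is cancelled once at the end.
      ratio-lower : ∀ B x y → (∀ n → x ^ n ≤ B * (y ^ n * f n)) → N * x ≤ y * (a + margin B)
      ratio-lower B x y le = ℕ.*-cancelˡ-≤ N (^-cancelˡ-≤ N (begin
        (N * (N * x)) ^ N                           ≡⟨ trans (^-distribʳ-* N N (N * x)) (cong (N ^ N *_) (^-distribʳ-* N N x)) ⟩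
        N ^ N * (N ^ N * x ^ N)                     ≤⟨ ℕ.*-monoʳ-≤ (N ^ N) (ℕ.*-monoʳ-≤ (N ^ N) (le N)) ⟩
        N ^ N * (N ^ N * (B * (y ^ N * f N)))       ≡⟨ lemma (N ^ N) B (y ^ N) (f N) ⟩
        y ^ N * ((B * N ^ N) * (N ^ N * f N))       ≤⟨ ℕ.*-monoʳ-≤ (y ^ N) (ℕ.*-mono-≤ (b*n^n≤[n+b]^n N B) ≤[1+a]^N) ⟩
        y ^ N * ((N + B) ^ N * suc a ^ N)           ≡⟨ trans (^-distribʳ-* N y _) (cong (y ^ N *_) (^-distribʳ-* N (N + B) (suc a))) ⟨
        (y * ((N + B) * suc a)) ^ N                 ≤⟨ ℕ.^-monoˡ-≤ N (ℕ.*-monoʳ-≤ y ([N+B]*[1+a]≤ B)) ⟩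
        (y * (N * (a + margin B))) ^ N              ≡⟨ cong (_^ N) (x∙yz≈y∙xz y N (a + margin B)) ⟩
        (N * (y * (a + margin B))) ^ N              ∎))
        where
        lemma : ∀ p b y f → p * (p * (b * (y * f))) ≡ y * ((b * p) * (p * f))
        lemma = solve-∀

      -- Computing f(N n) both ways gives f(N)ⁿ ≤ f(n N) ≤ C^N f(n)^N. The N-th root of C^N is C,
      -- whatever N is.
      a^n≤ : ∀ n → a ^ n ≤ (C * f n) * N ^ n
      a^n≤ n = ^-cancelˡ-≤ N (begin
        (a ^ n) ^ N                     ≡⟨ ^-comm a n N ⟩
        (a ^ N) ^ n                     ≤⟨ ℕ.^-monoˡ-≤ n a^N≤ ⟩
        (N ^ N * f N) ^ n               ≡⟨ ^-distribʳ-* n (N ^ N) (f N) ⟩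
        (N ^ N) ^ n * f N ^ n           ≤⟨ ℕ.*-mono-≤ (ℕ.≤-reflexive (^-comm N N n)) (f^≤ N n) ⟩
        (N ^ n) ^ N * f (n * N)         ≡⟨ cong (λ z → (N ^ n) ^ N * f z) (ℕ.*-comm n N) ⟩
        (N ^ n) ^ N * f (N * n)         ≤⟨ ℕ.*-monoʳ-≤ ((N ^ n) ^ N) (≤f^ n N) ⟩
        (N ^ n) ^ N * (C ^ N * f n ^ N) ≡⟨ ℕ.*-comm ((N ^ n) ^ N) _ ⟩
        (C ^ N * f n ^ N) * (N ^ n) ^ N ≡⟨ trans (^-distribʳ-* N (C * f n) (N ^ n)) (cong (_* (N ^ n) ^ N) (^-distribʳ-* N C (f n))) ⟨
        ((C * f n) * N ^ n) ^ N         ∎)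

      -- The roles of n and N are exchanged: f(n)^N ≤ f(N n) ≤ Cⁿ f(N)ⁿ. Now C appears only to the
      -- power n/N after taking roots, and the margin absorbs it.
      f*N^n≤ : ∀ n → f n * N ^ n ≤ (a + margin C) ^ n
      f*N^n≤ n = ℕ.*-cancelʳ-≤ _ _ (N ^ n) {{ℕ.m^n≢0 N n}} (^-cancelˡ-≤ N (begin
        (f n * N ^ n * N ^ n) ^ N
          ≡⟨ trans (^-distribʳ-* N (f n * N ^ n) (N ^ n)) (cong (_* (N ^ n) ^ N) (^-distribʳ-* N (f n) (N ^ n))) ⟩
        f n ^ N * (N ^ n) ^ N * (N ^ n) ^ N
          ≤⟨ ℕ.*-monoˡ-≤ ((N ^ n) ^ N) (ℕ.*-monoˡ-≤ ((N ^ n) ^ N) (begin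
               f n ^ N             ≤⟨ f^≤ n N ⟩
               f (N * n)           ≡⟨ cong f (ℕ.*-comm N n) ⟩
               f (n * N)           ≤⟨ ≤f^ N n ⟩
               C ^ n * f N ^ n     ∎)) ⟩
        C ^ n * f N ^ n * (N ^ n) ^ N * (N ^ n) ^ N
          ≡⟨ cong (λ z → C ^ n * f N ^ n * z * z) (^-comm N n N) ⟩
        C ^ n * f N ^ n * (N ^ N) ^ n * (N ^ N) ^ n
          ≡⟨ lemma (C ^ n) (f N ^ n) ((N ^ N) ^ n) ⟩
        (C ^ n * (N ^ N) ^ n) * ((N ^ N) ^ n * f N ^ n)
          ≡⟨ cong₂ _*_ (^-distribʳ-* n C (N ^ N)) (^-distribʳ-* n (N ^ N) (f N)) ⟨
        (C * N ^ N) ^ n * (N ^ N * f N) ^ n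
          ≤⟨ ℕ.*-mono-≤ (ℕ.^-monoˡ-≤ n (b*n^n≤[n+b]^n N C)) (ℕ.^-monoˡ-≤ n ≤[1+a]^N) ⟩
        ((N + C) ^ N) ^ n * (suc a ^ N) ^ n
          ≡⟨ cong₂ _*_ (^-comm (N + C) N n) (^-comm (suc a) N n) ⟩
        ((N + C) ^ n) ^ N * (suc a ^ n) ^ N
          ≡⟨ ^-distribʳ-* N ((N + C) ^ n) (suc a ^ n) ⟨
        ((N + C) ^ n * suc a ^ n) ^ N
          ≡⟨ cong (_^ N) (^-distribʳ-* n (N + C) (suc a)) ⟨
        (((N + C) * suc a) ^ n) ^ N
          ≤⟨ ℕ.^-monoˡ-≤ N (ℕ.^-monoˡ-≤ n ([N+B]*[1+a]≤ C)) ⟩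
        ((N * (a + margin C)) ^ n) ^ N
          ≡⟨ cong (_^ N) (trans (^-distribʳ-* n N (a + margin C)) (ℕ.*-comm (N ^ n) _)) ⟩
        ((a + margin C) ^ n * N ^ n) ^ N ∎))
        where
        lemma : ∀ c f p → c * f * p * p ≡ (c * p) * (p * f)
        lemma = solve-∀

      f*N^n≤2a^n : ∀ n → 2 * (n * margin C) ≤ i → f n * N ^ n ≤ 2 * a ^ n
      f*N^n≤2a^n n le = ℕ.≤-trans (f*N^n≤ n)
        ([a+b]^n≤2a^n a {{>-nonZero (ℕ.≤-trans (s≤s z≤n) N≤a)}} (margin C) n
          (ℕ.≤-trans le (ℕ.≤-trans (ℕ.n≤1+n i) N≤a)))

    -- The Cauchy estimate with denominators cleared: the j-th approximation bounds f(i+1) through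
    -- `f*N^n≤`, and f(i+1) bounds the i-th. The error `margin C` / (j+1) is independent of i.
    cross-≤ : ∀ i j → a i * suc j ≤ (a j + margin C) * suc i
    cross-≤ i j = ^-cancelˡ-≤ N (begin
      (a i * M) ^ N               ≡⟨ ^-distribʳ-* N (a i) M ⟩
      a i ^ N * M ^ N             ≤⟨ ℕ.*-monoˡ-≤ (M ^ N) (a^N≤ i) ⟩
      N ^ N * f N * M ^ N         ≡⟨ lemma (N ^ N) (f N) (M ^ N) ⟩
      f N * M ^ N * N ^ N         ≤⟨ ℕ.*-monoˡ-≤ (N ^ N) (f*N^n≤ j N) ⟩
      (a j + margin C) ^ N * N ^ N ≡⟨ ^-distribʳ-* N (a j + margin C) N ⟨
      ((a j + margin C) * N) ^ N ∎)
      where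
      N = suc i
      M = suc j
      lemma : ∀ p f m → p * f * m ≡ f * m * p
      lemma = solve-∀

open import Data.Integer using (+_; +[1+_])
open Renewal
open GrowthRate

open import Defs

-- Even palindromes

module _ {A : Set} where

  ++-align : ∀ (xs : List A) {ys} us {vs} → xs ++ ys ≡ us ++ vs → length xs ℕ.≤ length us →
             ∃ λ s → us ≡ xs ++ s × ys ≡ s ++ vs
  ++-align []       us       eq _ = us , refl , eq
  ++-align (x ∷ xs) (u ∷ us) eq (ℕ.s≤s le) with List.∷-injective eq
  ... | refl , eq′ with ++-align xs us eq′ le
  ... | s , refl , eq″ = s , refl , eq″

  ++-injective : ∀ (xs : List A) {ys} us {vs} → xs ++ ys ≡ us ++ vs → length xs ≡ length us →
                 xs ≡ us × ys ≡ vs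
  ++-injective []       []       eq _ = refl , eq
  ++-injective (x ∷ xs) (u ∷ us) eq le with List.∷-injective eq
  ... | refl , eq′ with ++-injective xs us eq′ (ℕ.suc-injective le)
  ... | refl , eq″ = refl , eq″

  evenPalindrome⇒reverse≡ : {w : List A} → EvenPalindrome w → reverse w ≡ w
  evenPalindrome⇒reverse≡ (x , _ , refl) =
    trans (List.reverse-++ x (reverse x)) (cong (_++ reverse x) (List.reverse-involutive x))

  evenPalindrome⇒2∣length : {w : List A} → EvenPalindrome w → 2 ∣ length w
  evenPalindrome⇒2∣length (x , _ , refl) = divides (length x)
    (trans (List.length-++ x) (trans (cong (length x ℕ.+_) (List.length-reverse x))
      (trans (cong (length x ℕ.+_) (sym (ℕ.+-identityʳ _))) (ℕ.*-comm 2 (length x)))))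

  evenPalindrome⇒≢[] : {w : List A} → EvenPalindrome w → ¬ w ≡ []
  evenPalindrome⇒≢[] p refl = []∉EvenPalindrome p

  evenPalindrome-split : ∀ (x y : List A) → length x ≡ length y → EvenPalindrome (x ++ y) →
                         y ≡ reverse x
  evenPalindrome-split x y len p =
    trans (sym (List.reverse-involutive y)) (cong reverse (proj₁ (++-injective (reverse y) x
      (trans (sym (List.reverse-++ x y)) (evenPalindrome⇒reverse≡ p))
      (trans (List.length-reverse y) (sym len)))))

  reverse≡⇒evenPalindrome : (w : List A) → ¬ w ≡ [] → reverse w ≡ w → 2 ∣ length w →
                            EvenPalindrome w
  reverse≡⇒evenPalindrome w w≢[] rev (divides h len) = x , x≢[] , trans (sym x++y≡w) (cong (x ++_) y≡)
    where
    x = take h w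
    y = drop h w

    x++y≡w : x ++ y ≡ w
    x++y≡w = List.take++drop≡id h w

    len′ : length w ≡ h ℕ.+ h
    len′ = trans len (trans (ℕ.*-comm h 2) (cong (h ℕ.+_) (ℕ.+-identityʳ h)))

    len-x : length x ≡ h
    len-x = trans (List.length-take h w)
      (ℕ.m≤n⇒m⊓n≡m (subst (h ℕ.≤_) (sym len′) (ℕ.m≤m+n h h)))

    len-y : length y ≡ h
    len-y = trans (List.length-drop h w) (trans (cong (ℕ._∸ h) len′) (ℕ.m+n∸n≡m h h))

    y≡ : y ≡ reverse x
    y≡ = sym (proj₂ (++-injective (reverse y) x
      (trans (sym (List.reverse-++ x y)) (trans (cong reverse x++y≡w) (trans rev (sym x++y≡w))))
      (trans (List.length-reverse y) (trans len-y (sym len-x)))))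

    x≢[] : ¬ x ≡ []
    x≢[] x≡[] = w≢[] (trans (sym x++y≡w) (cong₂ _++_ x≡[] (trans y≡ (cong reverse x≡[]))))

  HasPalPrefix NoPalPrefix Prime : List A → Set
  HasPalPrefix w = ∃₂ λ u v → w ≡ u ++ v × EvenPalindrome u
  NoPalPrefix w  = ¬ HasPalPrefix w
  Prime w     = EvenPalindrome w × ¬ ∃₂ λ u v → w ≡ u ++ v × ¬ v ≡ [] × EvenPalindrome u

  palindrome-flip : ∀ (u v : List A) → EvenPalindrome (u ++ v) → EvenPalindrome u →
                    reverse v ++ u ≡ u ++ v
  palindrome-flip u v uv pu = begin
    reverse v ++ u         ≡⟨ cong (reverse v ++_) (sym (evenPalindrome⇒reverse≡ pu)) ⟩
    reverse v ++ reverse u ≡⟨ sym (List.reverse-++ u v) ⟩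
    reverse (u ++ v)       ≡⟨ evenPalindrome⇒reverse≡ uv ⟩
    u ++ v                 ∎
    where open ≡-Reasoning

  2∣suffix : ∀ (u v : List A) → 2 ∣ length (u ++ v) → 2 ∣ length u → 2 ∣ length v
  2∣suffix u v uv u2 = ∣m+n∣m⇒∣n (subst (2 ∣_) (List.length-++ u) uv) u2

  2∣prefix : ∀ (u v : List A) → 2 ∣ length (u ++ v) → 2 ∣ length v → 2 ∣ length u
  2∣prefix u v uv v2 =
    ∣m+n∣m⇒∣n (subst (2 ∣_) (trans (List.length-++ u) (ℕ.+-comm (length u) (length v))) uv) v2

  -- The prefix u and the suffix u of u v = vᴿ u overlap in a shorter palindrome.
  palindrome-overlap : ∀ (u v : List A) → EvenPalindrome (u ++ v) → EvenPalindrome u →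
            length v ℕ.< length u → ∃ λ z → u ≡ z ++ v × EvenPalindrome z
  palindrome-overlap u v uv pu v<u
    with ++-align (reverse v) u (palindrome-flip u v uv pu)
           (subst (ℕ._≤ length u) (sym (List.length-reverse v)) (ℕ.<⇒≤ v<u))
  ... | z , u≡v′z , u≡zv = z , u≡zv , reverse≡⇒evenPalindrome z z≢[] rev 2∣z
    where
    z≢[] : ¬ z ≡ []
    z≢[] refl = ℕ.<-irrefl (cong length (sym u≡zv)) v<u

    rev : reverse z ≡ z
    rev = List.++-cancelˡ (reverse v) (reverse z) z (begin
      reverse v ++ reverse z ≡⟨ sym (List.reverse-++ z v) ⟩
      reverse (z ++ v)       ≡⟨ cong reverse (sym u≡zv) ⟩
      reverse u              ≡⟨ evenPalindrome⇒reverse≡ pu ⟩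
      u                      ≡⟨ u≡v′z ⟩
      reverse v ++ z         ∎)
      where open ≡-Reasoning

    2∣z : 2 ∣ length z
    2∣z = 2∣prefix z v (subst (λ t → 2 ∣ length t) u≡zv (evenPalindrome⇒2∣length pu))
            (2∣suffix u v (evenPalindrome⇒2∣length uv) (evenPalindrome⇒2∣length pu))

  nonempty⇒0<length : ∀ (v : List A) → ¬ v ≡ [] → 0 ℕ.< length v
  nonempty⇒0<length []      v≢[] = contradiction refl v≢[]
  nonempty⇒0<length (_ ∷ _) _    = ℕ.s≤s ℕ.z≤n

  -- Compare u with the first factor w of some factorisation, where w need not be prime. It cannot
  -- be shorter than u, as u is prime; so w = u s. If s is empty, the remaining factors give v. If s
  -- is nonempty and shorter than u, the two copies of u in w overlap in a proper palindromic prefix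
  -- of u. Otherwise s = y u, and v factors as y, u and the remaining factors, with y dropped if
  -- empty.
  prime-cancel : ∀ (u v : List A) → Prime u → Palstar (u ++ v) → Palstar v
  prime-cancel u v (pu , _) (zero , uv≡[]) =
    contradiction (List.++-conicalˡ u v uv≡[]) (evenPalindrome⇒≢[] pu)
  prime-cancel u v (pu , irr) (suc i , w , t , uv≡wt , pw , ps) with length u ℕ.≤? length w
  ... | no u≰w with ++-align w u (sym uv≡wt) (ℕ.<⇒≤ (ℕ.≰⇒> u≰w))
  ... | s , u≡ws , _ = contradiction (w , s , u≡ws , s≢[] , pw) irr
    where
    s≢[] : ¬ s ≡ []
    s≢[] refl = u≰w (ℕ.≤-reflexive (cong length (trans u≡ws (List.++-identityʳ w))))
  prime-cancel u v (pu , irr) (suc i , w , t , uv≡wt , pw , ps) | yes u≤w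
    with ++-align u w uv≡wt u≤w
  ... | [] , _ , v≡t = i , subst (Pow EvenPalindrome i) (sym v≡t) ps
  ... | s@(_ ∷ _) , refl , refl with length u ℕ.≤? length s
  ... | no u≰s = contradiction (z , s , u≡zs , (λ ()) , pz) irr
    where
    ov = palindrome-overlap u s pw pu (ℕ.≰⇒> u≰s)
    z = proj₁ ov
    u≡zs = proj₁ (proj₂ ov)
    pz = proj₂ (proj₂ ov)
  ... | yes u≤s
    with ++-align u (reverse s) (sym (palindrome-flip u s pw pu))
           (subst (length u ℕ.≤_) (sym (List.length-reverse s)) u≤s)
  ... | y , s′≡uy , s≡yu with y
  ... | [] = suc i , u , t , cong (_++ t) s≡yu , pu , ps
  ... | y′@(_ ∷ _) = suc (suc i) , y′ , u ++ t ,
                     trans (cong (_++ t) s≡yu) (List.++-assoc y′ u t) ,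
                     reverse≡⇒evenPalindrome y′ (λ ()) rev 2∣y ,
                     u , t , refl , pu , ps
    where
    rev : reverse y′ ≡ y′
    rev = List.++-cancelʳ u (reverse y′) y′ (begin
      reverse y′ ++ u         ≡⟨ cong (reverse y′ ++_) (sym (evenPalindrome⇒reverse≡ pu)) ⟩
      reverse y′ ++ reverse u ≡⟨ sym (List.reverse-++ u y′) ⟩
      reverse (u ++ y′)       ≡⟨ cong reverse (sym s′≡uy) ⟩
      reverse (reverse s)     ≡⟨ List.reverse-involutive s ⟩
      s                       ≡⟨ s≡yu ⟩
      y′ ++ u                 ∎)
      where open ≡-Reasoning
    2∣y : 2 ∣ length y′
    2∣y = 2∣prefix y′ u (subst (λ l → 2 ∣ length l) s≡yu
            (2∣suffix u s (evenPalindrome⇒2∣length pw) (evenPalindrome⇒2∣length pu)))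
            (evenPalindrome⇒2∣length pu)

  evenPalindrome-++ : ∀ {u v : List A} → EvenPalindrome u → Palstar v → Palstar (u ++ v)
  evenPalindrome-++ pu (i , p) = suc i , _ , _ , refl , pu , p

  palstar-++ : ∀ {u v : List A} → Palstar u → Palstar v → Palstar (u ++ v)
  palstar-++ (zero , refl) q = q
  palstar-++ {v = v} (suc i , x , y , refl , px , py) q =
    subst Palstar (sym (List.++-assoc x y v)) (evenPalindrome-++ px (palstar-++ (i , py) q))

  palstar⇒hasPalPrefix : ∀ {w : List A} → ¬ w ≡ [] → Palstar w → HasPalPrefix w
  palstar⇒hasPalPrefix w≢[] (zero , w≡[]) = contradiction w≡[] w≢[]
  palstar⇒hasPalPrefix w≢[] (suc i , u , v , eq , pu , _) = u , v , eq , pu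

  prime⇒noPalPrefixˡ : ∀ (x y : List A) → ¬ y ≡ [] → Prime (x ++ y) → NoPalPrefix x
  prime⇒noPalPrefixˡ x y y≢[] (_ , irr) (u , v , refl , pu) =
    irr (u , v ++ y , List.++-assoc u v y , (λ eq → y≢[] (List.++-conicalʳ v y eq)) , pu)

  -- Infinite descent. A proper palindromic prefix u longer than x covers more than half of the
  -- word, so it overlaps its copy at the other end in a shorter palindromic prefix. Eventually one
  -- fits inside x.
  noPalPrefix⇒prime : ∀ (x : List A) → ¬ x ≡ [] → NoPalPrefix x → Prime (x ++ reverse x)
  noPalPrefix⇒prime x x≢[] np = pw , λ (u , v , eq , v≢[] , pu) → <-rec Goal step (length u) u v refl eq v≢[] pu
    where
    w = x ++ reverse x
    pw : EvenPalindrome w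
    pw = x , x≢[] , refl

    Goal : ℕ → Set
    Goal n = ∀ u v → length u ≡ n → w ≡ u ++ v → ¬ v ≡ [] → ¬ EvenPalindrome u

    step : ∀ n → (∀ {m} → m ℕ.< n → Goal m) → Goal n
    step n rec u v refl w≡uv v≢[] pu with length u ℕ.≤? length x
    ... | yes u≤x with ++-align u x (sym w≡uv) u≤x
    ... | s , x≡us , _ = np (u , s , x≡us , pu)
    step n rec u v refl w≡uv v≢[] pu | no u≰x = rec z<u z (v ++ v) refl
        (trans w≡uv (trans (cong (_++ v) u≡zv) (List.++-assoc z v v)))
        (λ eq → v≢[] (List.++-conicalˡ v v eq)) pz
      where
      x<u : length x ℕ.< length u
      x<u = ℕ.≰⇒> u≰x

      len : length x ℕ.+ length x ≡ length u ℕ.+ length v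
      len = trans (cong (length x ℕ.+_) (sym (List.length-reverse x)))
        (trans (sym (List.length-++ x)) (trans (cong length w≡uv) (List.length-++ u)))

      v<u : length v ℕ.< length u
      v<u = ℕ.≰⇒> λ u≤v → ℕ.<-irrefl len (ℕ.+-mono-< x<u (ℕ.<-≤-trans x<u u≤v))

      ov = palindrome-overlap u v (subst EvenPalindrome w≡uv pw) pu v<u
      z = proj₁ ov
      u≡zv = proj₁ (proj₂ ov)
      pz = proj₂ (proj₂ ov)

      z<u : length z ℕ.< length u
      z<u = subst (length z ℕ.<_) (trans (sym (List.length-++ z)) (cong length (sym u≡zv)))
        (ℕ.m<m+n (length z) (nonempty⇒0<length v v≢[]))

  noPalPrefix-∷ʳ : ∀ (x : List A) a → NoPalPrefix (x ++ a ∷ []) → NoPalPrefix x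
  noPalPrefix-∷ʳ x a np (u , v , refl , pu) = np (u , v ++ a ∷ [] , List.++-assoc u v _ , pu)

  ∷ʳ-split : ∀ (x : List A) a u v → x ++ a ∷ [] ≡ u ++ v → ¬ v ≡ [] → ∃ λ v′ → x ≡ u ++ v′
  ∷ʳ-split x a u v eq v≢[] with ++-align u x (sym eq) u≤x
    where
    u≤x : length u ℕ.≤ length x
    u≤x = ℕ.≤-pred (ℕ.≤-trans (ℕ.m<m+n (length u) (nonempty⇒0<length v v≢[]))
      (ℕ.≤-reflexive (trans (sym (List.length-++ u)) (trans (cong length (sym eq))
        (trans (List.length-++ x) (ℕ.+-comm (length x) 1))))))
  ... | s , x≡us , _ = s , x≡us

  noPalPrefix⇒prime-∷ʳ : ∀ (x : List A) a → NoPalPrefix x → EvenPalindrome (x ++ a ∷ []) →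
                      Prime (x ++ a ∷ [])
  noPalPrefix⇒prime-∷ʳ x a np p = p , λ (u , v , eq , v≢[] , pu) →
    let (v′ , x≡uv′) = ∷ʳ-split x a u v eq v≢[] in np (u , v′ , x≡uv′ , pu)

  noPalPrefix⇒noPalPrefix-∷ʳ : ∀ (x : List A) a → NoPalPrefix x → ¬ EvenPalindrome (x ++ a ∷ []) →
                         NoPalPrefix (x ++ a ∷ [])
  noPalPrefix⇒noPalPrefix-∷ʳ x a np p (u , [] , eq , pu) =
    p (subst EvenPalindrome (sym (trans eq (List.++-identityʳ u))) pu)
  noPalPrefix⇒noPalPrefix-∷ʳ x a np p (u , v@(_ ∷ _) , eq , pu) =
    let (v′ , x≡uv′) = ∷ʳ-split x a u v eq (λ ()) in np (u , v′ , x≡uv′ , pu)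

  prime⇒hasPalPrefix : ∀ (w : List A) → Prime w → HasPalPrefix w
  prime⇒hasPalPrefix w (p , _) = w , [] , sym (List.++-identityʳ w) , p

  module _ (_≟_ : (w w′ : List A) → Dec (w ≡ w′)) where

    NoPalPrefix? : ∀ w → Dec (NoPalPrefix w)
    NoPalPrefix? w = ¬? (split? (λ u _ → EvenPalindrome? _≟_ u) w)

    Prime? : ∀ w → Dec (Prime w)
    Prime? w = EvenPalindrome? _≟_ w ×-dec
      ¬? (split? (λ u v → ¬? (v ≟ []) ×-dec EvenPalindrome? _≟_ u) w)

-- Counting words

private variable
  A B P Q R : Set

indicator : Dec P → ℕ
indicator (yes _) = 1
indicator (no _)  = 0

indicator-yes : (d : Dec P) → P → indicator d ≡ 1
indicator-yes (yes _) _ = refl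
indicator-yes (no ¬p) p = contradiction p ¬p

indicator-no : (d : Dec P) → ¬ P → indicator d ≡ 0
indicator-no (yes p) ¬p = contradiction p ¬p
indicator-no (no _)  _  = refl

indicator-× : (d : Dec P) (e : Dec Q) (f : Dec R) → (R → P × Q) → (P → Q → R) →
              indicator f ≡ indicator d ℕ.* indicator e
indicator-× (no ¬p) e       f to from = indicator-no f (¬p ∘ proj₁ ∘ to)
indicator-× (yes p) (no ¬q) f to from = indicator-no f (¬q ∘ proj₂ ∘ to)
indicator-× (yes p) (yes q) f to from = indicator-yes f (from p q)

indicator-*-mono : (d : Dec P) (e : Dec Q) (f : Dec R) → (P → Q → R) →
                   indicator d ℕ.* indicator e ℕ.≤ indicator f
indicator-*-mono (no _)  e       f from = z≤n
indicator-*-mono (yes p) (no _)  f from = z≤n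
indicator-*-mono (yes p) (yes q) f from = ℕ.≤-reflexive (sym (indicator-yes f (from p q)))

∑ : List A → (A → ℕ) → ℕ
∑ []       g = 0
∑ (x ∷ xs) g = g x ℕ.+ ∑ xs g

∑-++ : ∀ (xs ys : List A) g → ∑ (xs ++ ys) g ≡ ∑ xs g ℕ.+ ∑ ys g
∑-++ []       ys g = refl
∑-++ (x ∷ xs) ys g = trans (cong (g x ℕ.+_) (∑-++ xs ys g)) (sym (ℕ.+-assoc (g x) _ _))

∑-map : ∀ (h : A → B) xs g → ∑ (map h xs) g ≡ ∑ xs (g ∘ h)
∑-map h []       g = refl
∑-map h (x ∷ xs) g = cong (g (h x) ℕ.+_) (∑-map h xs g)

∑-mono : ∀ (xs : List A) {g h} → (∀ x → g x ℕ.≤ h x) → ∑ xs g ℕ.≤ ∑ xs h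
∑-mono []       le = z≤n
∑-mono (x ∷ xs) le = ℕ.+-mono-≤ (le x) (∑-mono xs le)

∑-cong : ∀ (xs : List A) {g h} → (∀ x → g x ≡ h x) → ∑ xs g ≡ ∑ xs h
∑-cong []       eq = refl
∑-cong (x ∷ xs) eq = cong₂ ℕ._+_ (eq x) (∑-cong xs eq)

∑-+ : ∀ (xs : List A) g h → ∑ xs (λ x → g x ℕ.+ h x) ≡ ∑ xs g ℕ.+ ∑ xs h
∑-+ []       g h = refl
∑-+ (x ∷ xs) g h = trans (cong (g x ℕ.+ h x ℕ.+_) (∑-+ xs g h)) (ℕ-+.interchange (g x) (h x) _ _)

∑-*ˡ : ∀ (xs : List A) c g → ∑ xs (λ x → c ℕ.* g x) ≡ c ℕ.* ∑ xs g
∑-*ˡ []       c g = sym (ℕ.*-zeroʳ c)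
∑-*ˡ (x ∷ xs) c g = trans (cong (c ℕ.* g x ℕ.+_) (∑-*ˡ xs c g)) (sym (ℕ.*-distribˡ-+ c (g x) _))

∑-*ʳ : ∀ (xs : List A) c g → ∑ xs (λ x → g x ℕ.* c) ≡ ∑ xs g ℕ.* c
∑-*ʳ xs c g = trans (∑-cong xs (λ x → ℕ.*-comm (g x) c)) (trans (∑-*ˡ xs c g) (ℕ.*-comm c _))

∑-const : ∀ (xs : List A) c → ∑ xs (λ _ → c) ≡ length xs ℕ.* c
∑-const []       c = refl
∑-const (x ∷ xs) c = cong (c ℕ.+_) (∑-const xs c)

∑-cartesianProductWith : ∀ {C : Set} (h : A → B → C) xs ys g →
  ∑ (cartesianProductWith h xs ys) g ≡ ∑ xs (λ x → ∑ ys (λ y → g (h x y)))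
∑-cartesianProductWith h []       ys g = refl
∑-cartesianProductWith h (x ∷ xs) ys g = trans (∑-++ (map (h x) ys) _ g)
  (cong₂ ℕ._+_ (∑-map (h x) ys g) (∑-cartesianProductWith h xs ys g))

length-filter≡∑ : {P : A → Set} (P? : ∀ x → Dec (P x)) (xs : List A) →
                  length (filter P? xs) ≡ ∑ xs (indicator ∘ P?)
length-filter≡∑ P? [] = refl
length-filter≡∑ P? (x ∷ xs) with P? x
... | yes _ = cong suc (length-filter≡∑ P? xs)
... | no  _ = length-filter≡∑ P? xs

∑-allFin-≟ : ∀ {k} (a : Fin k) → ∑ (allFin k) (λ b → indicator (b Fin.≟ a)) ≡ 1
∑-allFin-≟ {suc k} a = trans (cong (indicator (Fin.zero Fin.≟ a) ℕ.+_) tail≡) (lemma a)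
  where
  tail≡ : ∑ (tabulate Fin.suc) (λ b → indicator (b Fin.≟ a)) ≡
          ∑ (allFin k) (λ b → indicator (Fin.suc b Fin.≟ a))
  tail≡ = trans (cong (λ l → ∑ l (λ b → indicator (b Fin.≟ a))) (sym (List.map-tabulate id Fin.suc)))
    (∑-map Fin.suc (allFin k) _)
  lemma : ∀ a → indicator (Fin.zero Fin.≟ a) ℕ.+ ∑ (allFin k) (λ b → indicator (Fin.suc b Fin.≟ a)) ≡ 1
  lemma Fin.zero = cong suc (trans (∑-cong (allFin k) (λ b → indicator-no (Fin.suc b Fin.≟ Fin.zero) (λ ())))
    (trans (∑-const (allFin k) 0) (ℕ.*-zeroʳ (length (allFin k)))))
  lemma (Fin.suc a) = trans
    (cong₂ ℕ._+_ (indicator-no (Fin.zero Fin.≟ Fin.suc a) (λ ()))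
      (∑-cong (allFin k) (λ b → trans
        (indicator-× (b Fin.≟ a) (yes refl) (Fin.suc b Fin.≟ Fin.suc a)
          (λ eq → Fin.suc-injective eq , refl {x = k}) (λ eq _ → cong Fin.suc eq))
        (ℕ.*-identityʳ _))))
    (∑-allFin-≟ a)

module Counting (k : ℕ) where

  Word : Set
  Word = List (Fin k)

  _≟_ : (w w′ : Word) → Dec (w ≡ w′)
  _≟_ = List.≡-dec Fin._≟_

  ∑ʷ : ℕ → (Word → ℕ) → ℕ
  ∑ʷ m g = ∑ (words k m) g

  ∑ʷ-suc : ∀ m g → ∑ʷ (suc m) g ≡ ∑ (allFin k) (λ a → ∑ʷ m (λ w → g (a ∷ w)))
  ∑ʷ-suc m g = ∑-cartesianProductWith _∷_ (allFin k) (words k m) g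

  ∑ʷ-mono : ∀ m {g h} → (∀ w → length w ≡ m → g w ℕ.≤ h w) → ∑ʷ m g ℕ.≤ ∑ʷ m h
  ∑ʷ-mono zero    le = ℕ.+-mono-≤ (le [] refl) z≤n
  ∑ʷ-mono (suc m) {g} {h} le rewrite ∑ʷ-suc m g | ∑ʷ-suc m h =
    ∑-mono (allFin k) λ a → ∑ʷ-mono m (λ w len → le (a ∷ w) (cong suc len))

  ∑ʷ-cong : ∀ m {g h} → (∀ w → length w ≡ m → g w ≡ h w) → ∑ʷ m g ≡ ∑ʷ m h
  ∑ʷ-cong m eq = ℕ.≤-antisym (∑ʷ-mono m λ w l → ℕ.≤-reflexive (eq w l))
                             (∑ʷ-mono m λ w l → ℕ.≤-reflexive (sym (eq w l)))

  ∑ʷ-++ : ∀ m n g → ∑ʷ (m ℕ.+ n) g ≡ ∑ʷ m (λ x → ∑ʷ n (λ y → g (x ++ y)))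
  ∑ʷ-++ zero    n g = sym (ℕ.+-identityʳ _)
  ∑ʷ-++ (suc m) n g = trans (∑ʷ-suc (m ℕ.+ n) g)
    (trans (∑-cong (allFin k) (λ a → ∑ʷ-++ m n (λ w → g (a ∷ w)))) (sym (∑ʷ-suc m _)))

  ∑ʷ-0 : ∀ m {g} → (∀ w → length w ≡ m → g w ≡ 0) → ∑ʷ m g ≡ 0
  ∑ʷ-0 m eq = trans (∑ʷ-cong m eq) (trans (∑-const (words k m) 0) (ℕ.*-zeroʳ (length (words k m))))

  ∑ʷ-1-const : ∀ c → ∑ʷ 1 (λ _ → c) ≡ k ℕ.* c
  ∑ʷ-1-const c = trans (∑ʷ-suc 0 _) (trans (∑-cong (allFin k) (λ _ → ℕ.+-identityʳ c))
    (trans (∑-const (allFin k) c) (cong (ℕ._* c) (List.length-tabulate (id {A = Fin k})))))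

  -- Used to sum out the second half of a prime, which the first half determines.
  ∑ʷ-≟ : ∀ u → ∑ʷ (length u) (λ w → indicator (w ≟ u)) ≡ 1
  ∑ʷ-≟ [] = refl
  ∑ʷ-≟ (a ∷ u) = begin
    ∑ʷ (suc m) (λ w → indicator (w ≟ (a ∷ u)))
      ≡⟨ ∑ʷ-suc m _ ⟩
    ∑ (allFin k) (λ b → ∑ʷ m (λ w → indicator ((b ∷ w) ≟ (a ∷ u))))
      ≡⟨ ∑-cong (allFin k) (λ b → trans
           (∑ʷ-cong m λ w _ → indicator-× (b Fin.≟ a) (w ≟ u) ((b ∷ w) ≟ (a ∷ u)) List.∷-injective (cong₂ _∷_))
           (∑-*ˡ (words k m) (indicator (b Fin.≟ a)) (λ w → indicator (w ≟ u)))) ⟩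
    ∑ (allFin k) (λ b → indicator (b Fin.≟ a) ℕ.* ∑ʷ m (λ w → indicator (w ≟ u)))
      ≡⟨ ∑-*ʳ (allFin k) (∑ʷ m (λ w → indicator (w ≟ u))) _ ⟩
    ∑ (allFin k) (λ b → indicator (b Fin.≟ a)) ℕ.* ∑ʷ m (λ w → indicator (w ≟ u))
      ≡⟨ cong₂ ℕ._*_ (∑-allFin-≟ a) (∑ʷ-≟ u) ⟩
    1 ∎
    where
    open ≡-Reasoning
    m = length u

  palstar noPalPrefix prime : Word → ℕ
  palstar  = indicator ∘ Palstar? _≟_
  noPalPrefix = indicator ∘ NoPalPrefix? _≟_
  prime    = indicator ∘ Prime? _≟_

  #palstar #noPalPrefix #prime : ℕ → ℕ
  #palstar m  = ∑ʷ m palstar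
  #noPalPrefix m = ∑ʷ m noPalPrefix
  #prime m    = ∑ʷ m prime

  numPalstars≡#palstar : ∀ m → numPalstars k m ≡ #palstar m
  numPalstars≡#palstar m = length-filter≡∑ (Palstar? _≟_) (words k m)

  #palstar-0 : #palstar 0 ≡ 1
  #palstar-0 = cong (ℕ._+ 0) (indicator-yes (Palstar? _≟_ []) (0 , refl))

  []-noPalPrefix : NoPalPrefix {Fin k} []
  []-noPalPrefix (u , v , eq , pu) = evenPalindrome⇒≢[] pu (List.++-conicalˡ u v (sym eq))

  #noPalPrefix-0 : #noPalPrefix 0 ≡ 1
  #noPalPrefix-0 = cong (ℕ._+ 0) (indicator-yes (NoPalPrefix? _≟_ []) []-noPalPrefix)

  #palstar-*≤ : ∀ m n → #palstar m ℕ.* #palstar n ℕ.≤ #palstar (m ℕ.+ n)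
  #palstar-*≤ m n = begin
    #palstar m ℕ.* #palstar n
      ≡⟨ sym (∑-*ʳ (words k m) (#palstar n) palstar) ⟩
    ∑ʷ m (λ x → palstar x ℕ.* #palstar n)
      ≤⟨ ∑ʷ-mono m (λ x _ → ℕ.≤-trans (ℕ.≤-reflexive (sym (∑-*ˡ (words k n) (palstar x) palstar)))
           (∑ʷ-mono n λ y _ → indicator-*-mono (Palstar? _≟_ x) (Palstar? _≟_ y) (Palstar? _≟_ (x ++ y)) palstar-++)) ⟩
    ∑ʷ m (λ x → ∑ʷ n (λ y → palstar (x ++ y)))
      ≡⟨ sym (∑ʷ-++ m n palstar) ⟩
    #palstar (m ℕ.+ n) ∎
    where open ℕ.≤-Reasoning

  #prime-odd : ∀ j → #prime (suc (j ℕ.+ j)) ≡ 0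
  #prime-odd j = ∑ʷ-0 (suc (j ℕ.+ j)) λ w len → indicator-no (Prime? _≟_ w) λ (p , _) →
    odd j (subst (2 ∣_) len (evenPalindrome⇒2∣length p))
    where
    odd : ∀ j → ¬ 2 ∣ suc (j ℕ.+ j)
    odd zero    (divides (suc _) ())
    odd (suc j) d = odd j (∣m+n∣m⇒∣n {2} {2} (subst (2 ∣_) (cong (suc ∘ suc) (ℕ.+-suc j j)) d) (divides 1 refl))

  length≡0⇒≡[] : ∀ (x : Word) → length x ≡ 0 → x ≡ []
  length≡0⇒≡[] [] _ = refl

  prime-++ : ∀ x y → ¬ x ≡ [] → length x ≡ length y →
             prime (x ++ y) ≡ noPalPrefix x ℕ.* indicator (y ≟ reverse x)
  prime-++ x y x≢[] len = indicator-× (NoPalPrefix? _≟_ x) (y ≟ reverse x) (Prime? _≟_ (x ++ y))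
    (λ p → prime⇒noPalPrefixˡ x y y≢[] p , evenPalindrome-split x y len (proj₁ p))
    (λ { np refl → noPalPrefix⇒prime x x≢[] np })
    where
    y≢[] : ¬ y ≡ []
    y≢[] refl = x≢[] (length≡0⇒≡[] x len)

  #prime-double : ∀ j → #prime (suc j ℕ.+ suc j) ≡ #noPalPrefix (suc j)
  #prime-double j = trans (∑ʷ-++ n n prime) (∑ʷ-cong n λ x len → begin
    ∑ʷ n (λ y → prime (x ++ y))
      ≡⟨ ∑ʷ-cong n (λ y len′ → prime-++ x y (λ { refl → contradiction len λ () }) (trans len (sym len′))) ⟩
    ∑ʷ n (λ y → noPalPrefix x ℕ.* indicator (y ≟ reverse x))
      ≡⟨ ∑-*ˡ (words k n) (noPalPrefix x) _ ⟩
    noPalPrefix x ℕ.* ∑ʷ n (λ y → indicator (y ≟ reverse x))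
      ≡⟨ cong (λ l → noPalPrefix x ℕ.* ∑ʷ l (λ y → indicator (y ≟ reverse x)))
           (sym (trans (List.length-reverse x) len)) ⟩
    noPalPrefix x ℕ.* ∑ʷ (length (reverse x)) (λ y → indicator (y ≟ reverse x))
      ≡⟨ cong (noPalPrefix x ℕ.*_) (∑ʷ-≟ (reverse x)) ⟩
    noPalPrefix x ℕ.* 1
      ≡⟨ ℕ.*-identityʳ _ ⟩
    noPalPrefix x ∎)
    where
    open ≡-Reasoning
    n = suc j

  -- A palindromic prefix that first appears with the last letter must be the whole word, which is
  -- then prime; and a prefix already present in x excludes both alternatives. The letter is a word
  -- of length 1 so that sums over concatenations apply.
  noPalPrefix-extend : ∀ x y → length y ≡ 1 → noPalPrefix x ≡ noPalPrefix (x ++ y) ℕ.+ prime (x ++ y)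
  noPalPrefix-extend x (a ∷ []) _ with NoPalPrefix? _≟_ x
  ... | no ¬np = sym (cong₂ ℕ._+_
    (indicator-no (NoPalPrefix? _≟_ (x ++ a ∷ [])) (¬np ∘ noPalPrefix-∷ʳ x a))
    (indicator-no (Prime? _≟_ (x ++ a ∷ [])) (¬np ∘ prime⇒noPalPrefixˡ x (a ∷ []) (λ ()))))
  ... | yes np = sym (case (EvenPalindrome? _≟_ (x ++ a ∷ [])))
    where
    case : Dec (EvenPalindrome (x ++ a ∷ [])) → noPalPrefix (x ++ a ∷ []) ℕ.+ prime (x ++ a ∷ []) ≡ 1
    case (yes p) = cong₂ ℕ._+_
      (indicator-no (NoPalPrefix? _≟_ (x ++ a ∷ []))
        (λ np′ → np′ (prime⇒hasPalPrefix _ (noPalPrefix⇒prime-∷ʳ x a np p))))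
      (indicator-yes (Prime? _≟_ (x ++ a ∷ [])) (noPalPrefix⇒prime-∷ʳ x a np p))
    case (no ¬p) = cong₂ ℕ._+_
      (indicator-yes (NoPalPrefix? _≟_ (x ++ a ∷ [])) (noPalPrefix⇒noPalPrefix-∷ʳ x a np ¬p))
      (indicator-no (Prime? _≟_ (x ++ a ∷ [])) (¬p ∘ proj₁))

  #noPalPrefix-suc : ∀ n → k ℕ.* #noPalPrefix n ≡ #noPalPrefix (suc n) ℕ.+ #prime (suc n)
  #noPalPrefix-suc n = begin
    k ℕ.* #noPalPrefix n
      ≡⟨ sym (∑-*ˡ (words k n) k noPalPrefix) ⟩
    ∑ʷ n (λ x → k ℕ.* noPalPrefix x)
      ≡⟨ ∑ʷ-cong n (λ x _ → trans (sym (∑ʷ-1-const (noPalPrefix x))) (∑ʷ-cong 1 λ y len → noPalPrefix-extend x y len)) ⟩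
    ∑ʷ n (λ x → ∑ʷ 1 (λ y → noPalPrefix (x ++ y) ℕ.+ prime (x ++ y)))
      ≡⟨ sym (∑ʷ-++ n 1 _) ⟩
    ∑ʷ (n ℕ.+ 1) (λ w → noPalPrefix w ℕ.+ prime w)
      ≡⟨ cong (λ m → ∑ʷ m (λ w → noPalPrefix w ℕ.+ prime w)) (ℕ.+-comm n 1) ⟩
    ∑ʷ (suc n) (λ w → noPalPrefix w ℕ.+ prime w)
      ≡⟨ ∑-+ (words k (suc n)) noPalPrefix prime ⟩
    #noPalPrefix (suc n) ℕ.+ #prime (suc n) ∎
    where open ≡-Reasoning

  -- Palstars of length i + j whose first prime factor is longer than i.  Moving one letter from
  -- y to x splits off those whose first factor has length exactly i + 1.
  #pending : ℕ → ℕ → ℕ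
  #pending i j = ∑ʷ i (λ x → ∑ʷ j (λ y → noPalPrefix x ℕ.* palstar (x ++ y)))

  -- The one place where cancellation of primes enters the count.
  prime-*-palstar : ∀ u v → prime u ℕ.* palstar (u ++ v) ≡ prime u ℕ.* palstar v
  prime-*-palstar u v with Prime? _≟_ u
  ... | no _  = refl
  ... | yes p = trans
    (sym (indicator-× (yes p) (Palstar? _≟_ (u ++ v)) (Palstar? _≟_ v)
      (λ ps → p , evenPalindrome-++ (proj₁ p) ps) (λ _ → prime-cancel u v p)))
    (sym (ℕ.*-identityˡ _))

  #pending-0 : ∀ j → #pending 0 j ≡ #palstar j
  #pending-0 j = trans (ℕ.+-identityʳ _) (∑ʷ-cong j λ y _ →
    trans (cong (ℕ._* palstar y) (indicator-yes (NoPalPrefix? _≟_ []) []-noPalPrefix)) (ℕ.*-identityˡ _))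

  -- A nonempty palstar starts with an even palindrome, so its first prime factor cannot still be
  -- incomplete when the word ends.
  #pending-suc-0 : ∀ i → #pending (suc i) 0 ≡ 0
  #pending-suc-0 i = ∑ʷ-0 (suc i) λ x len → trans (ℕ.+-identityʳ _) (zero* x len)
    where
    zero* : ∀ x → length x ≡ suc i → noPalPrefix x ℕ.* palstar (x ++ []) ≡ 0
    zero* x len with NoPalPrefix? _≟_ x
    ... | no _   = refl
    ... | yes np = trans (ℕ.*-identityˡ _) (indicator-no (Palstar? _≟_ (x ++ [])) λ ps →
      np (palstar⇒hasPalPrefix (λ { refl → contradiction len λ () }) (subst Palstar (List.++-identityʳ x) ps)))

  #pending-suc : ∀ i j → #pending i (suc j) ≡ #pending (suc i) j ℕ.+ #prime (suc i) ℕ.* #palstar j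
  #pending-suc i j = begin
    #pending i (suc j)
      ≡⟨ ∑ʷ-cong i (λ x _ → trans (∑ʷ-++ 1 j (λ y → noPalPrefix x ℕ.* palstar (x ++ y)))
           (∑ʷ-cong 1 λ a len → ∑ʷ-cong j λ y _ → cong₂ ℕ._*_
             (noPalPrefix-extend x a len) (cong palstar (sym (List.++-assoc x a y))))) ⟩
    ∑ʷ i (λ x → ∑ʷ 1 (λ a → G (x ++ a)))
      ≡⟨ sym (∑ʷ-++ i 1 G) ⟩
    ∑ʷ (i ℕ.+ 1) G
      ≡⟨ cong (λ m → ∑ʷ m G) (ℕ.+-comm i 1) ⟩
    ∑ʷ (suc i) G
      ≡⟨ ∑ʷ-cong (suc i) (λ u _ → trans
           (∑ʷ-cong j λ y _ → trans (ℕ.*-distribʳ-+ (palstar (u ++ y)) (noPalPrefix u) (prime u))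
             (cong (noPalPrefix u ℕ.* palstar (u ++ y) ℕ.+_) (prime-*-palstar u y)))
           (trans (∑-+ (words k j) _ _)
             (cong (∑ʷ j (λ y → noPalPrefix u ℕ.* palstar (u ++ y)) ℕ.+_) (∑-*ˡ (words k j) (prime u) palstar)))) ⟩
    ∑ʷ (suc i) (λ u → ∑ʷ j (λ y → noPalPrefix u ℕ.* palstar (u ++ y)) ℕ.+ prime u ℕ.* #palstar j)
      ≡⟨ ∑-+ (words k (suc i)) _ _ ⟩
    #pending (suc i) j ℕ.+ ∑ʷ (suc i) (λ u → prime u ℕ.* #palstar j)
      ≡⟨ cong (#pending (suc i) j ℕ.+_) (∑-*ʳ (words k (suc i)) (#palstar j) prime) ⟩
    #pending (suc i) j ℕ.+ #prime (suc i) ℕ.* #palstar j ∎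
    where
    open ≡-Reasoning
    G : Word → ℕ
    G u = ∑ʷ j (λ y → (noPalPrefix u ℕ.+ prime u) ℕ.* palstar (u ++ y))

  f : ℕ → ℕ
  f n = numPalstars k (2 ℕ.* n)

  #palstar-double : ∀ n → #palstar (n ℕ.+ n) ≡ f n
  #palstar-double n = trans (cong (λ m → #palstar (n ℕ.+ m)) (sym (ℕ.+-identityʳ n)))
    (sym (numPalstars≡#palstar (2 ℕ.* n)))

  f-0 : f 0 ≡ 1
  f-0 = trans (numPalstars≡#palstar 0) #palstar-0

  f-supermultiplicative : ∀ m n → f m ℕ.* f n ℕ.≤ f (m ℕ.+ n)
  f-supermultiplicative m n = begin
    f m ℕ.* f n                             ≡⟨ cong₂ ℕ._*_ (#palstar-double m) (#palstar-double n) ⟨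
    #palstar (m ℕ.+ m) ℕ.* #palstar (n ℕ.+ n)   ≤⟨ #palstar-*≤ (m ℕ.+ m) (n ℕ.+ n) ⟩
    #palstar ((m ℕ.+ m) ℕ.+ (n ℕ.+ n))            ≡⟨ cong #palstar (ℕ-+.interchange m m n n) ⟩
    #palstar ((m ℕ.+ n) ℕ.+ (m ℕ.+ n))            ≡⟨ #palstar-double (m ℕ.+ n) ⟩
    f (m ℕ.+ n)                               ∎
    where open ℕ.≤-Reasoning

  -- Two letters are moved at once. The first move splits off nothing, because primes have even
  -- length.
  #pending-double : ∀ i j → #pending (i ℕ.+ i) (suc j ℕ.+ suc j) ≡
                    #noPalPrefix (suc i) ℕ.* f j ℕ.+ #pending (suc i ℕ.+ suc i) (j ℕ.+ j)
  #pending-double i j rewrite ℕ.+-suc j j = begin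
    #pending (i ℕ.+ i) (suc (suc (j ℕ.+ j)))
      ≡⟨ #pending-suc (i ℕ.+ i) (suc (j ℕ.+ j)) ⟩
    #pending (suc (i ℕ.+ i)) (suc (j ℕ.+ j)) ℕ.+ #prime (suc (i ℕ.+ i)) ℕ.* #palstar (suc (j ℕ.+ j))
      ≡⟨ cong₂ ℕ._+_ (#pending-suc (suc (i ℕ.+ i)) (j ℕ.+ j)) (cong (ℕ._* #palstar (suc (j ℕ.+ j))) (#prime-odd i)) ⟩
    #pending (suc (suc (i ℕ.+ i))) (j ℕ.+ j) ℕ.+ #prime (suc (suc (i ℕ.+ i))) ℕ.* #palstar (j ℕ.+ j) ℕ.+ 0
      ≡⟨ ℕ.+-identityʳ _ ⟩
    #pending (suc (suc (i ℕ.+ i))) (j ℕ.+ j) ℕ.+ #prime (suc (suc (i ℕ.+ i))) ℕ.* #palstar (j ℕ.+ j)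
      ≡⟨ cong (λ m → #pending m (j ℕ.+ j) ℕ.+ #prime m ℕ.* #palstar (j ℕ.+ j)) (cong suc (sym (ℕ.+-suc i i))) ⟩
    #pending (suc i ℕ.+ suc i) (j ℕ.+ j) ℕ.+ #prime (suc i ℕ.+ suc i) ℕ.* #palstar (j ℕ.+ j)
      ≡⟨ ℕ.+-comm (#pending (suc i ℕ.+ suc i) (j ℕ.+ j)) _ ⟩
    #prime (suc i ℕ.+ suc i) ℕ.* #palstar (j ℕ.+ j) ℕ.+ #pending (suc i ℕ.+ suc i) (j ℕ.+ j)
      ≡⟨ cong₂ (λ p x → p ℕ.* x ℕ.+ #pending (suc i ℕ.+ suc i) (j ℕ.+ j)) (#prime-double i) (#palstar-double j) ⟩
    #noPalPrefix (suc i) ℕ.* f j ℕ.+ #pending (suc i ℕ.+ suc i) (j ℕ.+ j) ∎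
    where open ≡-Reasoning

  #pending≡conv : ∀ i j → #pending (i ℕ.+ i) (suc j ℕ.+ suc j) ≡ conv (λ t → #noPalPrefix (suc (i ℕ.+ t))) f j
  #pending≡conv i zero = trans (#pending-double i 0)
    (trans (cong (#noPalPrefix (suc i) ℕ.* f 0 ℕ.+_) (#pending-suc-0 (i ℕ.+ suc i)))
      (trans (ℕ.+-identityʳ _) (cong (λ m → #noPalPrefix (suc m) ℕ.* f 0) (sym (ℕ.+-identityʳ i)))))
  #pending≡conv i (suc j) = trans (#pending-double i (suc j)) (cong₂ ℕ._+_
    (cong (λ m → #noPalPrefix (suc m) ℕ.* f (suc j)) (sym (ℕ.+-identityʳ i)))
    (trans (#pending≡conv (suc i) j)
      (conv-congˡ f j λ t → cong (#noPalPrefix ∘ suc) (sym (ℕ.+-suc i t)))))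

  f-suc : ∀ n → f (suc n) ≡ conv (#noPalPrefix ∘ suc) f n
  f-suc n = trans (sym (#palstar-double (suc n)))
    (trans (sym (#pending-0 (suc n ℕ.+ suc n))) (#pending≡conv 0 n))

-- The limit of the roots as a real number

ℕ→ℚ-+ : ∀ m n → ℕ→ℚ (m ℕ.+ n) ≡ ℕ→ℚ m ℚ.+ ℕ→ℚ n
ℕ→ℚ-+ m n = ℚ.toℚᵘ-injective (ℚᵘ.≃-trans (ℚᵘ.*≡* eq) (ℚᵘ.≃-sym (ℚ.toℚᵘ-homo-+ (ℕ→ℚ m) (ℕ→ℚ n))))
  where
  eq : + (m ℕ.+ n) ℤ.* + 1 ≡ (+ m ℤ.* + 1 ℤ.+ + n ℤ.* + 1) ℤ.* + 1
  eq = cong (ℤ._* + 1) (sym (cong₂ ℤ._+_ (ℤ.*-identityʳ (+ m)) (ℤ.*-identityʳ (+ n))))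

ℕ→ℚ-* : ∀ m n → ℕ→ℚ (m ℕ.* n) ≡ ℕ→ℚ m ℚ.* ℕ→ℚ n
ℕ→ℚ-* m n = ℚ.toℚᵘ-injective (ℚᵘ.≃-trans (ℚᵘ.*≡* eq) (ℚᵘ.≃-sym (ℚ.toℚᵘ-homo-* (ℕ→ℚ m) (ℕ→ℚ n))))
  where
  eq : + (m ℕ.* n) ℤ.* + 1 ≡ (+ m ℤ.* + n) ℤ.* + 1
  eq = cong (ℤ._* + 1) (ℤ.pos-* m n)

ℕ→ℚ-mono-≤ : ∀ {m n} → m ℕ.≤ n → ℕ→ℚ m ℚ.≤ ℕ→ℚ n
ℕ→ℚ-mono-≤ le = ℚ.*≤* (ℤ.*-monoʳ-≤-nonNeg (+ 1) (ℤ.+≤+ le))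

ℕ→ℚ-mono-< : ∀ {m n} → m ℕ.< n → ℕ→ℚ m ℚ.< ℕ→ℚ n
ℕ→ℚ-mono-< lt = ℚ.*<* (ℤ.*-monoʳ-<-pos (+ 1) (ℤ.+<+ lt))

ℕ→ℚ-pos : ∀ n .{{_ : ℕ.NonZero n}} → ℚ.Positive (ℕ→ℚ n)
ℕ→ℚ-pos (suc n) = _

archimedean : ∀ ε → 0ℚ ℚ.< ε → ∀ K → ∃ λ N → ∀ n → N ℕ.≤ n → ℕ→ℚ K ℚ.< ε ℚ.* ℕ→ℚ (suc n)
archimedean ε@(mkℚ (+ 0) _ _) (ℚ.*<* (ℤ.+<+ ())) K
-- Here ε = (p+1)/(d+1), so ε (d+1) ≥ 1 and every n + 1 > K (d+1) is large enough.
archimedean ε@(mkℚ +[1+ p ] d _) 0<ε K = K ℕ.* suc d , λ n N≤n → begin-strict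
  ℕ→ℚ K                                 ≡⟨ ℚ.*-identityˡ (ℕ→ℚ K) ⟨
  1ℚ ℚ.* ℕ→ℚ K                          ≤⟨ ℚ.*-monoʳ-≤-nonNeg (ℕ→ℚ K) 1≤εd ⟩
  ε ℚ.* ℕ→ℚ (suc d) ℚ.* ℕ→ℚ K           ≡⟨ ℚ.*-assoc ε (ℕ→ℚ (suc d)) (ℕ→ℚ K) ⟩
  ε ℚ.* (ℕ→ℚ (suc d) ℚ.* ℕ→ℚ K)         ≡⟨ cong (ε ℚ.*_) (ℕ→ℚ-* (suc d) K) ⟨
  ε ℚ.* ℕ→ℚ (suc d ℕ.* K)               <⟨ ℚ.*-monoʳ-<-pos ε (ℕ→ℚ-mono-<
                                             (s≤s (ℕ.≤-trans (ℕ.≤-reflexive (ℕ.*-comm (suc d) K)) N≤n))) ⟩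
  ε ℚ.* ℕ→ℚ (suc n)                     ∎
  where
  open ℚ.≤-Reasoning
  1≤εd : 1ℚ ℚ.≤ ε ℚ.* ℕ→ℚ (suc d)
  1≤εd = ℚ.toℚᵘ-cancel-≤ (ℚᵘ.≤-trans
    (ℚᵘ.*≤* (ℤ.+≤+ (ℕ.≤-trans (ℕ.≤-reflexive (trans (ℕ.*-identityˡ _) (ℕ.*-identityʳ (suc d))))
      (ℕ.≤-trans (ℕ.m≤m+n (suc d) (p ℕ.* suc d)) (ℕ.≤-reflexive (sym (ℕ.*-identityʳ _)))))))
    (ℚᵘ.≤-reflexive (ℚᵘ.≃-sym (ℚ.toℚᵘ-homo-* ε (ℕ→ℚ (suc d))))))

p≤q+r⇒p-r≤q : ∀ {p q r} → p ℚ.≤ q ℚ.+ r → p ℚ.- r ℚ.≤ q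
p≤q+r⇒p-r≤q {p} {q} {r} le = begin
  p ℚ.- r           ≤⟨ ℚ.+-monoˡ-≤ (ℚ.- r) le ⟩
  q ℚ.+ r ℚ.- r     ≡⟨ ℚ.+-assoc q r (ℚ.- r) ⟩
  q ℚ.+ (r ℚ.- r)   ≡⟨ cong (q ℚ.+_) (ℚ.+-inverseʳ r) ⟩
  q ℚ.+ 0ℚ          ≡⟨ ℚ.+-identityʳ q ⟩
  q                 ∎
  where open ℚ.≤-Reasoning

p+r≤q⇒p≤q-r : ∀ {p q r} → p ℚ.+ r ℚ.≤ q → p ℚ.≤ q ℚ.- r
p+r≤q⇒p≤q-r {p} {q} {r} le = begin
  p                 ≡⟨ ℚ.+-identityʳ p ⟨
  p ℚ.+ 0ℚ          ≡⟨ cong (p ℚ.+_) (ℚ.+-inverseʳ r) ⟨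
  p ℚ.+ (r ℚ.- r)   ≡⟨ ℚ.+-assoc p r (ℚ.- r) ⟨
  p ℚ.+ r ℚ.- r     ≤⟨ ℚ.+-monoˡ-≤ (ℚ.- r) le ⟩
  q ℚ.- r           ∎
  where open ℚ.≤-Reasoning

p<q+r⇒p-q<r : ∀ {p q r} → p ℚ.< q ℚ.+ r → p ℚ.- q ℚ.< r
p<q+r⇒p-q<r {p} {q} {r} lt = begin-strict
  p ℚ.- q             <⟨ ℚ.+-monoˡ-< (ℚ.- q) lt ⟩
  q ℚ.+ r ℚ.- q       ≡⟨ cong (ℚ._- q) (ℚ.+-comm q r) ⟩
  r ℚ.+ q ℚ.- q       ≡⟨ ℚ.+-assoc r q (ℚ.- q) ⟩
  r ℚ.+ (q ℚ.- q)     ≡⟨ cong (r ℚ.+_) (ℚ.+-inverseʳ q) ⟩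
  r ℚ.+ 0ℚ            ≡⟨ ℚ.+-identityʳ r ⟩
  r                   ∎
  where open ℚ.≤-Reasoning

∣p-q∣<r : ∀ {p q r} → p ℚ.< q ℚ.+ r → q ℚ.< p ℚ.+ r → ∣ p ℚ.- q ∣ ℚ.< r
∣p-q∣<r {p} {q} {r} p<q+r q<p+r with ℚ.∣p∣≡p∨∣p∣≡-p (p ℚ.- q)
... | inj₁ eq = subst (ℚ._< r) (sym eq) (p<q+r⇒p-q<r p<q+r)
... | inj₂ eq = subst (ℚ._< r) (sym (trans eq (ℚ-Ring.⁻¹-anti-homo‿- p q))) (p<q+r⇒p-q<r q<p+r)

module Limit (f : ℕ → ℕ) (c U : ℕ)
  (f-0   : f 0 ≡ 1)
  (1≤f   : ∀ n → 1 ℕ.≤ f n)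
  (super : ∀ m n → f m ℕ.* f n ℕ.≤ f (m ℕ.+ n))
  (sub   : ∀ m n → f (m ℕ.+ n) ℕ.≤ suc c ℕ.* (f m ℕ.* f n))
  (f≤    : ∀ n → f n ℕ.≤ U ℕ.^ n)
  where

  open Roots f (suc c) U f-0 1≤f super sub f≤ public
  open ℚ.≤-Reasoning

  C K : ℕ
  C = suc c
  K = margin C

  αs : ℕ → ℚ
  αs i = ℕ→ℚ (a i) ℚ.* 1/ ℕ→ℚ (suc i)

  αs*N : ∀ i → αs i ℚ.* ℕ→ℚ (suc i) ≡ ℕ→ℚ (a i)
  αs*N i = begin-equality
    ℕ→ℚ (a i) ℚ.* 1/ N ℚ.* N     ≡⟨ ℚ.*-assoc (ℕ→ℚ (a i)) (1/ N) N ⟩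
    ℕ→ℚ (a i) ℚ.* (1/ N ℚ.* N)   ≡⟨ cong (ℕ→ℚ (a i) ℚ.*_) (ℚ.*-inverseˡ N) ⟩
    ℕ→ℚ (a i) ℚ.* 1ℚ             ≡⟨ ℚ.*-identityʳ (ℕ→ℚ (a i)) ⟩
    ℕ→ℚ (a i)                    ∎
    where N = ℕ→ℚ (suc i)

  αs*n*N : ∀ i n → αs i ℚ.* ℕ→ℚ n ℚ.* ℕ→ℚ (suc i) ≡ ℕ→ℚ (a i ℕ.* n)
  αs*n*N i n = begin-equality
    αs i ℚ.* ℕ→ℚ n ℚ.* ℕ→ℚ (suc i)    ≡⟨ ℚ-*.xy∙z≈xz∙y (αs i) (ℕ→ℚ n) (ℕ→ℚ (suc i)) ⟩
    αs i ℚ.* ℕ→ℚ (suc i) ℚ.* ℕ→ℚ n    ≡⟨ cong (ℚ._* ℕ→ℚ n) (αs*N i) ⟩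
    ℕ→ℚ (a i) ℚ.* ℕ→ℚ n               ≡⟨ ℕ→ℚ-* (a i) n ⟨
    ℕ→ℚ (a i ℕ.* n)                   ∎

  αs-close : ∀ i j ε → ℕ→ℚ K ℚ.< ε ℚ.* ℕ→ℚ (suc j) → αs i ℚ.< αs j ℚ.+ ε
  αs-close i j ε K<εM = ℚ.*-cancelʳ-<-nonNeg M (begin-strict
    αs i ℚ.* M              ≤⟨ ℚ.*-cancelʳ-≤-pos (ℕ→ℚ (suc i)) (begin
      αs i ℚ.* M ℚ.* ℕ→ℚ (suc i)           ≡⟨ αs*n*N i (suc j) ⟩
      ℕ→ℚ (a i ℕ.* suc j)                  ≤⟨ ℕ→ℚ-mono-≤ (cross-≤ i j) ⟩
      ℕ→ℚ ((a j ℕ.+ K) ℕ.* suc i)          ≡⟨ ℕ→ℚ-* (a j ℕ.+ K) (suc i) ⟩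
      ℕ→ℚ (a j ℕ.+ K) ℚ.* ℕ→ℚ (suc i)      ∎) ⟩
    ℕ→ℚ (a j ℕ.+ K)           ≡⟨ ℕ→ℚ-+ (a j) K ⟩
    ℕ→ℚ (a j) ℚ.+ ℕ→ℚ K       ≡⟨ cong (ℚ._+ ℕ→ℚ K) (αs*N j) ⟨
    αs j ℚ.* M ℚ.+ ℕ→ℚ K      <⟨ ℚ.+-monoʳ-< (αs j ℚ.* M) K<εM ⟩
    αs j ℚ.* M ℚ.+ ε ℚ.* M    ≡⟨ ℚ.*-distribʳ-+ M (αs j) ε ⟨
    (αs j ℚ.+ ε) ℚ.* M        ∎)
    where M = ℕ→ℚ (suc j)

  α : ℝ
  α = mkℝ αs λ ε 0<ε → let (N , large) = archimedean ε 0<ε K in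
    N , λ i j N≤i N≤j → ∣p-q∣<r (αs-close i j ε (large j N≤j)) (αs-close j i ε (large i N≤i))

  α^n*N^n : ∀ n i → seq (α ^ n) i ℚ.* ℕ→ℚ (suc i ℕ.^ n) ≡ ℕ→ℚ (a i ℕ.^ n)
  α^n*N^n zero    i = refl
  α^n*N^n (suc n) i = begin-equality
    αs i ℚ.* z ℚ.* ℕ→ℚ (suc i ℕ.* M)          ≡⟨ cong (αs i ℚ.* z ℚ.*_) (ℕ→ℚ-* (suc i) M) ⟩
    αs i ℚ.* z ℚ.* (ℕ→ℚ (suc i) ℚ.* ℕ→ℚ M)    ≡⟨ ℚ-*.interchange (αs i) z (ℕ→ℚ (suc i)) (ℕ→ℚ M) ⟩
    αs i ℚ.* ℕ→ℚ (suc i) ℚ.* (z ℚ.* ℕ→ℚ M)    ≡⟨ cong₂ ℚ._*_ (αs*N i) (α^n*N^n n i) ⟩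
    ℕ→ℚ (a i) ℚ.* ℕ→ℚ (a i ℕ.^ n)             ≡⟨ ℕ→ℚ-* (a i) (a i ℕ.^ n) ⟨
    ℕ→ℚ (a i ℕ.^ suc n)                       ∎
    where
    z = seq (α ^ n) i
    M = suc i ℕ.^ n

  α^n≤C*f : ∀ n i → seq (α ^ n) i ℚ.≤ ℕ→ℚ C ℚ.* ℕ→ℚ (f n)
  α^n≤C*f n i = ℚ.*-cancelʳ-≤-pos (ℕ→ℚ M) {{ℕ→ℚ-pos M {{ℕ.m^n≢0 (suc i) n}}}} (begin
    seq (α ^ n) i ℚ.* ℕ→ℚ M             ≡⟨ α^n*N^n n i ⟩
    ℕ→ℚ (a i ℕ.^ n)                     ≤⟨ ℕ→ℚ-mono-≤ (a^n≤ i n) ⟩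
    ℕ→ℚ (C ℕ.* f n ℕ.* M)               ≡⟨ ℕ→ℚ-* (C ℕ.* f n) M ⟩
    ℕ→ℚ (C ℕ.* f n) ℚ.* ℕ→ℚ M           ≡⟨ cong (ℚ._* ℕ→ℚ M) (ℕ→ℚ-* C (f n)) ⟩
    ℕ→ℚ C ℚ.* ℕ→ℚ (f n) ℚ.* ℕ→ℚ M       ∎)
    where M = suc i ℕ.^ n

  -- The margin vanishes only in the limit; on the approximations the factor 2 absorbs it. The
  -- threshold may grow with n, since an inequality of reals concerns the tail of the sequences for
  -- each fixed n.
  f≤2α^n : ∀ n i → 2 ℕ.* (n ℕ.* K) ℕ.≤ i → ℕ→ℚ (f n) ℚ.≤ ℕ→ℚ 2 ℚ.* seq (α ^ n) i
  f≤2α^n n i le = ℚ.*-cancelʳ-≤-pos (ℕ→ℚ M) {{ℕ→ℚ-pos M {{ℕ.m^n≢0 (suc i) n}}}} (begin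
    ℕ→ℚ (f n) ℚ.* ℕ→ℚ M                    ≡⟨ ℕ→ℚ-* (f n) M ⟨
    ℕ→ℚ (f n ℕ.* M)                        ≤⟨ ℕ→ℚ-mono-≤ (f*N^n≤2a^n i n le) ⟩
    ℕ→ℚ (2 ℕ.* a i ℕ.^ n)                  ≡⟨ ℕ→ℚ-* 2 (a i ℕ.^ n) ⟩
    ℕ→ℚ 2 ℚ.* ℕ→ℚ (a i ℕ.^ n)              ≡⟨ cong (ℕ→ℚ 2 ℚ.*_) (α^n*N^n n i) ⟨
    ℕ→ℚ 2 ℚ.* (seq (α ^ n) i ℚ.* ℕ→ℚ M)    ≡⟨ ℚ.*-assoc (ℕ→ℚ 2) (seq (α ^ n) i) (ℕ→ℚ M) ⟨
    ℕ→ℚ 2 ℚ.* seq (α ^ n) i ℚ.* ℕ→ℚ M      ∎)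
    where M = suc i ℕ.^ n

  p≤p+ε : ∀ p {ε} → 0ℚ ℚ.< ε → p ℚ.≤ p ℚ.+ ε
  p≤p+ε p {ε} 0<ε = subst (ℚ._≤ p ℚ.+ ε) (ℚ.+-identityʳ p) (ℚ.+-monoʳ-≤ p (ℚ.<⇒≤ 0<ε))

  0<fromℚ : ∀ p → 0ℚ ℚ.< p → fromℚ 0ℚ < fromℚ p
  0<fromℚ p 0<p = p , 0<p , 0 , λ _ _ → ℚ.≤-reflexive (ℚ.+-identityˡ p)

  f∈Θα^n : (λ n → fromℕ (f n)) ∈Θ (λ n → α ^ n)
  f∈Θα^n = fromℚ 1/C , fromℚ (ℕ→ℚ 2) , 0<fromℚ 1/C (ℚ.positive⁻¹ 1/C {{1/C-pos}}) ,
    0<fromℚ (ℕ→ℚ 2) (ℚ.positive⁻¹ (ℕ→ℚ 2)) , 0 , λ n _ →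
      (λ ε 0<ε → 0 , λ i _ → begin
        1/C ℚ.* seq (α ^ n) i                 ≤⟨ ℚ.*-monoˡ-≤-nonNeg 1/C {{ℚ.pos⇒nonNeg 1/C {{1/C-pos}}}} (α^n≤C*f n i) ⟩
        1/C ℚ.* (ℕ→ℚ C ℚ.* ℕ→ℚ (f n))         ≡⟨ ℚ.*-assoc 1/C (ℕ→ℚ C) (ℕ→ℚ (f n)) ⟨
        1/C ℚ.* ℕ→ℚ C ℚ.* ℕ→ℚ (f n)           ≡⟨ cong (ℚ._* ℕ→ℚ (f n)) (ℚ.*-inverseˡ (ℕ→ℚ C)) ⟩
        1ℚ ℚ.* ℕ→ℚ (f n)                      ≡⟨ ℚ.*-identityˡ (ℕ→ℚ (f n)) ⟩
        ℕ→ℚ (f n)                             ≤⟨ p≤p+ε (ℕ→ℚ (f n)) 0<ε ⟩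
        ℕ→ℚ (f n) ℚ.+ ε                       ∎) ,
      (λ ε 0<ε → 2 ℕ.* (n ℕ.* K) , λ i le → ℚ.≤-trans (f≤2α^n n i le) (p≤p+ε _ 0<ε))
    where
    1/C : ℚ
    1/C = 1/ ℕ→ℚ C
    1/C-pos : ℚ.Positive 1/C
    1/C-pos = ℚ.1/pos⇒pos (ℕ→ℚ C)

-- Location of the growth rate of palstars

module PalstarGrowth (t : ℕ) where

  k : ℕ
  k = 2 ℕ.+ t

  open Counting k
  open Growth t #noPalPrefix #prime f #noPalPrefix-0 #noPalPrefix-suc #prime-odd #prime-double f-0 f-suc
  open Limit f 4 (2 ℕ.* k) f-0 1≤f f-supermultiplicative f-submultiplicative f≤ public

  -- This is a/N + 1/(8k) + 1/2 ≤ 2k multiplied by 8k N. The gap 1/(8k) is a simpler number just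
  -- below the 1/(8k - 2) that `f-upper` provides.
  a-upper : ∀ i → a i ℕ.* (8 ℕ.* k) ℕ.+ (1 ℕ.+ 4 ℕ.* k) ℕ.* suc i ℕ.≤ 2 ℕ.* k ℕ.* (8 ℕ.* k) ℕ.* suc i
  a-upper i = ℕ.*-cancelˡ-≤ (7 ℕ.+ 4 ℕ.* t) (begin
    (7 ℕ.+ 4 ℕ.* t) ℕ.* (x ℕ.* (8 ℕ.* k) ℕ.+ (1 ℕ.+ 4 ℕ.* k) ℕ.* N)
      ≡⟨ lemma t x N ⟩
    8 ℕ.* k ℕ.* ((7 ℕ.+ 4 ℕ.* t) ℕ.* x) ℕ.+ (7 ℕ.+ 4 ℕ.* t) ℕ.* (1 ℕ.+ 4 ℕ.* k) ℕ.* N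
      ≤⟨ ℕ.+-monoˡ-≤ _ (ℕ.*-monoʳ-≤ (8 ℕ.* k)
           (ratio-upper i (7 ℕ.+ 4 ℕ.* t) (2 ℕ.* k ℕ.* (6 ℕ.+ 4 ℕ.* t))
             (geometric-upper (7 ℕ.+ 4 ℕ.* t) (2 ℕ.* k ℕ.* (6 ℕ.+ 4 ℕ.* t)) f-upper))) ⟩
    8 ℕ.* k ℕ.* (N ℕ.* (2 ℕ.* k ℕ.* (6 ℕ.+ 4 ℕ.* t))) ℕ.+ (7 ℕ.+ 4 ℕ.* t) ℕ.* (1 ℕ.+ 4 ℕ.* k) ℕ.* N
      -- The spare N completes (4k - 1)(4k + 1) + 1 = 16k².
      ≤⟨ ℕ.m≤m+n _ N ⟩
    8 ℕ.* k ℕ.* (N ℕ.* (2 ℕ.* k ℕ.* (6 ℕ.+ 4 ℕ.* t))) ℕ.+ (7 ℕ.+ 4 ℕ.* t) ℕ.* (1 ℕ.+ 4 ℕ.* k) ℕ.* N ℕ.+ N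
      ≡⟨ lemma₂ t N ⟩
    (7 ℕ.+ 4 ℕ.* t) ℕ.* (2 ℕ.* k ℕ.* (8 ℕ.* k) ℕ.* N) ∎)
    where
    open ℕ.≤-Reasoning
    N = suc i
    x = a i
    lemma : ∀ t x n → (7 ℕ.+ 4 ℕ.* t) ℕ.* (x ℕ.* (8 ℕ.* (2 ℕ.+ t)) ℕ.+ (1 ℕ.+ 4 ℕ.* (2 ℕ.+ t)) ℕ.* n) ≡
            8 ℕ.* (2 ℕ.+ t) ℕ.* ((7 ℕ.+ 4 ℕ.* t) ℕ.* x) ℕ.+ (7 ℕ.+ 4 ℕ.* t) ℕ.* (1 ℕ.+ 4 ℕ.* (2 ℕ.+ t)) ℕ.* n
    lemma = solve-∀
    lemma₂ : ∀ t n → 8 ℕ.* (2 ℕ.+ t) ℕ.* (n ℕ.* (2 ℕ.* (2 ℕ.+ t) ℕ.* (6 ℕ.+ 4 ℕ.* t))) ℕ.+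
             (7 ℕ.+ 4 ℕ.* t) ℕ.* (1 ℕ.+ 4 ℕ.* (2 ℕ.+ t)) ℕ.* n ℕ.+ n ≡
             (7 ℕ.+ 4 ℕ.* t) ℕ.* (2 ℕ.* (2 ℕ.+ t) ℕ.* (8 ℕ.* (2 ℕ.+ t)) ℕ.* n)
    lemma₂ = solve-∀

  K′ : ℕ
  K′ = margin (T ℕ.^ 2)

  -- This is 2k + 1/16 ≤ a/N + 1 multiplied by 16 N. Of the gap 1/8 from `f-lower`, half is kept and
  -- half covers the margin, which is at most N/16 for these i.
  a-lower : ∀ i → 16 ℕ.* K′ ℕ.≤ i → (2 ℕ.* k ℕ.* 16 ℕ.+ 1) ℕ.* suc i ℕ.≤ a i ℕ.* 16 ℕ.+ 16 ℕ.* suc i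
  a-lower i le = begin
    (2 ℕ.* k ℕ.* 16 ℕ.+ 1) ℕ.* N                  ≡⟨ lemma t N ⟩
    2 ℕ.* (N ℕ.* T) ℕ.+ 15 ℕ.* N                  ≤⟨ ℕ.+-monoˡ-≤ (15 ℕ.* N) (ℕ.*-monoʳ-≤ 2 (ratio-lower i (T ℕ.^ 2) T 8 T^n≤)) ⟩
    2 ℕ.* (8 ℕ.* (x ℕ.+ K′)) ℕ.+ 15 ℕ.* N         ≡⟨ lemma₂ x K′ N ⟩
    x ℕ.* 16 ℕ.+ (16 ℕ.* K′ ℕ.+ 15 ℕ.* N)         ≤⟨ ℕ.+-monoʳ-≤ (x ℕ.* 16) (ℕ.+-monoˡ-≤ (15 ℕ.* N) (ℕ.m≤n⇒m≤1+n le)) ⟩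
    x ℕ.* 16 ℕ.+ 16 ℕ.* N                         ∎
    where
    open ℕ.≤-Reasoning
    N = suc i
    x = a i
    lemma : ∀ t n → (2 ℕ.* (2 ℕ.+ t) ℕ.* 16 ℕ.+ 1) ℕ.* n ≡ 2 ℕ.* (n ℕ.* (25 ℕ.+ 16 ℕ.* t)) ℕ.+ 15 ℕ.* n
    lemma = solve-∀
    lemma₂ : ∀ x c n → 2 ℕ.* (8 ℕ.* (x ℕ.+ c)) ℕ.+ 15 ℕ.* n ≡ x ℕ.* 16 ℕ.+ (16 ℕ.* c ℕ.+ 15 ℕ.* n)
    lemma₂ = solve-∀

  2k-1<α : fromℚ (ℕ→ℚ (2 ℕ.* k) ℚ.- 1ℚ) < α
  2k-1<α = ε , ℚ.positive⁻¹ ε , 16 ℕ.* K′ , λ i le → begin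
    p ℚ.- 1ℚ ℚ.+ ε        ≡⟨ ℚ.+-assoc p (ℚ.- 1ℚ) ε ⟩
    p ℚ.+ (ℚ.- 1ℚ ℚ.+ ε)  ≡⟨ ℚ.+-assoc p ε (ℚ.- 1ℚ) ⟨
    p ℚ.+ ε ℚ.- 1ℚ        ≤⟨ p≤q+r⇒p-r≤q {r = 1ℚ} (bound i le) ⟩
    αs i                  ∎
    where
    open ℚ.≤-Reasoning
    p = ℕ→ℚ (2 ℕ.* k)
    ε = 1/ ℕ→ℚ 16
    bound : ∀ i → 16 ℕ.* K′ ℕ.≤ i → p ℚ.+ ε ℚ.≤ αs i ℚ.+ 1ℚ
    bound i le = ℚ.*-cancelʳ-≤-pos (ℕ→ℚ 16) (ℚ.*-cancelʳ-≤-pos N (begin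
      (p ℚ.+ ε) ℚ.* ℕ→ℚ 16 ℚ.* N                  ≡⟨ cong (ℚ._* N) (ℚ.*-distribʳ-+ (ℕ→ℚ 16) p ε) ⟩
      (p ℚ.* ℕ→ℚ 16 ℚ.+ ℕ→ℚ 1) ℚ.* N              ≡⟨ cong (λ x → (x ℚ.+ ℕ→ℚ 1) ℚ.* N) (ℕ→ℚ-* (2 ℕ.* k) 16) ⟨
      (ℕ→ℚ (2 ℕ.* k ℕ.* 16) ℚ.+ ℕ→ℚ 1) ℚ.* N      ≡⟨ cong (ℚ._* N) (ℕ→ℚ-+ (2 ℕ.* k ℕ.* 16) 1) ⟨
      ℕ→ℚ (2 ℕ.* k ℕ.* 16 ℕ.+ 1) ℚ.* N            ≡⟨ ℕ→ℚ-* (2 ℕ.* k ℕ.* 16 ℕ.+ 1) (suc i) ⟨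
      ℕ→ℚ ((2 ℕ.* k ℕ.* 16 ℕ.+ 1) ℕ.* suc i)      ≤⟨ ℕ→ℚ-mono-≤ (a-lower i le) ⟩
      ℕ→ℚ (a i ℕ.* 16 ℕ.+ 16 ℕ.* suc i)           ≡⟨ ℕ→ℚ-+ (a i ℕ.* 16) (16 ℕ.* suc i) ⟩
      ℕ→ℚ (a i ℕ.* 16) ℚ.+ ℕ→ℚ (16 ℕ.* suc i)     ≡⟨ cong₂ ℚ._+_ (sym (αs*n*N i 16)) (ℕ→ℚ-* 16 (suc i)) ⟩
      αs i ℚ.* ℕ→ℚ 16 ℚ.* N ℚ.+ ℕ→ℚ 16 ℚ.* N      ≡⟨ ℚ.*-distribʳ-+ N (αs i ℚ.* ℕ→ℚ 16) (ℕ→ℚ 16) ⟨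
      (αs i ℚ.* ℕ→ℚ 16 ℚ.+ 1ℚ ℚ.* ℕ→ℚ 16) ℚ.* N   ≡⟨ cong (ℚ._* N) (ℚ.*-distribʳ-+ (ℕ→ℚ 16) (αs i) 1ℚ) ⟨
      (αs i ℚ.+ 1ℚ) ℚ.* ℕ→ℚ 16 ℚ.* N              ∎))
      where N = ℕ→ℚ (suc i)

  α<2k-½ : α < fromℚ (ℕ→ℚ (2 ℕ.* k) ℚ.- ½)
  α<2k-½ = ε , ℚ.positive⁻¹ ε {{ℚ.1/pos⇒pos E}} , 0 , λ i _ → p+r≤q⇒p≤q-r {r = ½} (bound i)
    where
    open ℚ.≤-Reasoning
    E = ℕ→ℚ (8 ℕ.* k)
    ε = 1/ E
    ½E : ½ ℚ.* E ≡ ℕ→ℚ (4 ℕ.* k)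
    ½E = begin-equality
      ½ ℚ.* E                           ≡⟨ cong (λ x → ½ ℚ.* ℕ→ℚ x) (ℕ.*-assoc 2 4 k) ⟩
      ½ ℚ.* ℕ→ℚ (2 ℕ.* (4 ℕ.* k))       ≡⟨ cong (½ ℚ.*_) (ℕ→ℚ-* 2 (4 ℕ.* k)) ⟩
      ½ ℚ.* (ℕ→ℚ 2 ℚ.* ℕ→ℚ (4 ℕ.* k))   ≡⟨ ℚ.*-assoc ½ (ℕ→ℚ 2) (ℕ→ℚ (4 ℕ.* k)) ⟨
      1ℚ ℚ.* ℕ→ℚ (4 ℕ.* k)              ≡⟨ ℚ.*-identityˡ (ℕ→ℚ (4 ℕ.* k)) ⟩
      ℕ→ℚ (4 ℕ.* k)                     ∎
    scaled-sum : ∀ x → (x ℚ.+ ε ℚ.+ ½) ℚ.* E ≡ x ℚ.* E ℚ.+ ℕ→ℚ (1 ℕ.+ 4 ℕ.* k)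
    scaled-sum x = begin-equality
      (x ℚ.+ ε ℚ.+ ½) ℚ.* E                     ≡⟨ ℚ.*-distribʳ-+ E (x ℚ.+ ε) ½ ⟩
      (x ℚ.+ ε) ℚ.* E ℚ.+ ½ ℚ.* E               ≡⟨ cong₂ ℚ._+_ (ℚ.*-distribʳ-+ E x ε) ½E ⟩
      x ℚ.* E ℚ.+ ε ℚ.* E ℚ.+ ℕ→ℚ (4 ℕ.* k)     ≡⟨ cong (λ z → x ℚ.* E ℚ.+ z ℚ.+ ℕ→ℚ (4 ℕ.* k)) (ℚ.*-inverseˡ E) ⟩
      x ℚ.* E ℚ.+ ℕ→ℚ 1 ℚ.+ ℕ→ℚ (4 ℕ.* k)       ≡⟨ ℚ.+-assoc (x ℚ.* E) (ℕ→ℚ 1) (ℕ→ℚ (4 ℕ.* k)) ⟩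
      x ℚ.* E ℚ.+ (ℕ→ℚ 1 ℚ.+ ℕ→ℚ (4 ℕ.* k))     ≡⟨ cong (x ℚ.* E ℚ.+_) (ℕ→ℚ-+ 1 (4 ℕ.* k)) ⟨
      x ℚ.* E ℚ.+ ℕ→ℚ (1 ℕ.+ 4 ℕ.* k)           ∎
    bound : ∀ i → αs i ℚ.+ ε ℚ.+ ½ ℚ.≤ ℕ→ℚ (2 ℕ.* k)
    bound i = ℚ.*-cancelʳ-≤-pos E (ℚ.*-cancelʳ-≤-pos N (begin
      (αs i ℚ.+ ε ℚ.+ ½) ℚ.* E ℚ.* N                        ≡⟨ cong (ℚ._* N) (scaled-sum (αs i)) ⟩
      (αs i ℚ.* E ℚ.+ ℕ→ℚ (1 ℕ.+ 4 ℕ.* k)) ℚ.* N            ≡⟨ ℚ.*-distribʳ-+ N (αs i ℚ.* E) (ℕ→ℚ (1 ℕ.+ 4 ℕ.* k)) ⟩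
      αs i ℚ.* E ℚ.* N ℚ.+ ℕ→ℚ (1 ℕ.+ 4 ℕ.* k) ℚ.* N        ≡⟨ cong₂ ℚ._+_ (αs*n*N i (8 ℕ.* k)) (sym (ℕ→ℚ-* (1 ℕ.+ 4 ℕ.* k) (suc i))) ⟩
      ℕ→ℚ (a i ℕ.* (8 ℕ.* k)) ℚ.+ ℕ→ℚ ((1 ℕ.+ 4 ℕ.* k) ℕ.* suc i) ≡⟨ ℕ→ℚ-+ (a i ℕ.* (8 ℕ.* k)) ((1 ℕ.+ 4 ℕ.* k) ℕ.* suc i) ⟨
      ℕ→ℚ (a i ℕ.* (8 ℕ.* k) ℕ.+ (1 ℕ.+ 4 ℕ.* k) ℕ.* suc i) ≤⟨ ℕ→ℚ-mono-≤ (a-upper i) ⟩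
      ℕ→ℚ (2 ℕ.* k ℕ.* (8 ℕ.* k) ℕ.* suc i)                 ≡⟨ ℕ→ℚ-* (2 ℕ.* k ℕ.* (8 ℕ.* k)) (suc i) ⟩
      ℕ→ℚ (2 ℕ.* k ℕ.* (8 ℕ.* k)) ℚ.* N                     ≡⟨ cong (ℚ._* N) (ℕ→ℚ-* (2 ℕ.* k) (8 ℕ.* k)) ⟩
      ℕ→ℚ (2 ℕ.* k) ℚ.* E ℚ.* N                             ∎))
      where N = ℕ→ℚ (suc i)

theorem3 : (k : ℕ) → 2 ℕ.≤ k →
    ∃ λ (α : ℝ) →
    fromℚ (ℕ→ℚ (2 ℕ.* k) ℚ.- 1ℚ) < α ×
    α < fromℚ (ℕ→ℚ (2 ℕ.* k) ℚ.- ½) ×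
    (λ n → fromℕ (numPalstars k (2 ℕ.* n))) ∈Θ (λ n → α ^ n)
theorem3 (suc (suc t)) (s≤s (s≤s _)) = α , 2k-1<α , α<2k-½ , f∈Θα^n
  where open PalstarGrowth t
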